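{- For every positive integer $r$ there is a constant $J>0$ such that the following holds. Let $V$ be a finite set, let $\mathcal{F} \subseteq 2^V$ be an increasing family, and let $p>0$. If $\mathcal{F}$ is weakly $(Jp,r)$-small, then $\mathcal{F}$ is $p$-small.
   Context: For a finite set $V$, $2^V$ denotes the power set of $V$. A family $\mathcal{F} \subseteq 2^V$ is increasing if $B \supseteq A \in \mathcal{F}$ implies $B \in \mathcal{F}$. For $\mathcal{G} \subseteq 2^V$, $\langle \mathcal{G} \rangle = \{B \subseteq V : \exists A \in \mathcal{G},\ B \supseteq A\}$ is the increasing family generated by $\mathcal{G}$. For $p>0$, $\mathcal{F}$ is called $p$-small if there is $\mathcal{G} \subseteq 2^V$ with $\langle \mathcal{G} \rangle \supseteq \mathcal{F}$ and $\sum_{S \in \mathcal{G}} p^{|S|} \le 1/2$. For $p>0$, $\mathcal{F}$ is called weakly $(p,r)$-small if there is a function $\lambda : 2^V \to [0,\infty)$, with $\lambda_S = 0$ whenever $|S| > r$, such that $\sum_{S \subseteq I} \lambda_S \ge 1$ for every $I \in \mathcal{F}$ and $\sum_{S \subseteq V} \lambda_S\, p^{|S|} \le 1/2$ (with $p^0 = 1$ for $S=\emptyset$).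
   Formalization: The number p and the values of the weight function λ in the definition of weakly (Jp,r)-small are taken to be rational instead of real; the constant J is likewise found as a rational number. -}

module Defs where

open import Data.Nat using (ℕ; zero; suc; _>_)
open import Data.Bool using (Bool)
open import Data.List using (List; []; _∷_; map)
open import Data.List.Membership.Propositional using (_∈_)
open import Data.Product using (Σ; _×_; ∃; ∃-syntax)
import Data.Vec as Vec
open import Data.Fin.Subset using (Subset; _⊆_; ∣_∣; inside; outside)
open import Data.Fin.Subset.Properties using (_⊆?_)
open import Data.Rational using (ℚ; 0ℚ; 1ℚ; ½; _+_; _*_; _≤_)
open import Relation.Nullary using (yes; no)
open import Relation.Binary.PropositionalEquality using (_≡_)
open import Level using (0ℓ; suc)
open import Relation.Unary using (Pred)

-- The ground set V is modelled as Fin n; a subset of V is a 'Subset n'.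
-- A family F ⊆ 2^V is a predicate on subsets.
Family : ℕ → Set₁
Family n = Pred (Subset n) 0ℓ

_^ℚ_ : ℚ → ℕ → ℚ
p ^ℚ zero  = 1ℚ
p ^ℚ suc k = p * (p ^ℚ k)

sumℚ : List ℚ → ℚ
sumℚ []       = 0ℚ
sumℚ (x ∷ xs) = x + sumℚ xs

sumSubsets : (n : ℕ) → (Subset n → ℚ) → ℚ
sumSubsets zero    f = f Vec.[]
sumSubsets (suc n) f =
  sumSubsets n (λ s → f (outside Vec.∷ s)) + sumSubsets n (λ s → f (inside Vec.∷ s))

sumSubsetsOf : {n : ℕ} → Subset n → (Subset n → ℚ) → ℚ
sumSubsetsOf {n} I f = sumSubsets n (λ S → g S)
  where
  g : Subset _ → ℚ
  g S with S ⊆? I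
  ... | yes _ = f S
  ... | no  _ = 0ℚ

Increasing : {n : ℕ} → Family n → Set
Increasing {n} F = ∀ (A B : Subset n) → A ⊆ B → F A → F B

CoveredBy : {n : ℕ} → Family n → List (Subset n) → Set
CoveredBy {n} F G = ∀ (I : Subset n) → F I → ∃[ A ] (A ∈ G × A ⊆ I)

-- F is p-small.  (G is given as a finite list; since a finite family is
-- a list without repetition, and repetitions only increase the sum,
-- this is equivalent to quantifying over subfamilies G ⊆ 2^V.)
Small : {n : ℕ} → ℚ → Family n → Set
Small {n} p F =
  ∃[ G ] (CoveredBy F G × (sumℚ (map (λ S → p ^ℚ ∣ S ∣) G) ≤ ½))

WeaklySmall : {n : ℕ} → ℚ → ℕ → Family n → Set
WeaklySmall {n} p r F =
  ∃[ λf ] ( (∀ (S : Subset n) → 0ℚ ≤ λf S)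
          × (∀ (S : Subset n) → ∣ S ∣ > r → λf S ≡ 0ℚ)
          × (∀ (I : Subset n) → F I → 1ℚ ≤ sumSubsetsOf I λf)
          × (sumSubsets n (λ S → λf S * (p ^ℚ ∣ S ∣)) ≤ ½) )

{-# OPTIONS --safe #-}

-- Put q = Jp and let W be q-random.  For I with Σ_{S ⊆ I} λ_S ≥ 1 rank the
-- vertices of I by their degree Σ_{v ∈ S ⊆ I} λ_S, and write I_j for the j
-- heaviest ones.  With m = 4r, let i be the last index with m |I_i ∖ W| ≥ i;
-- then equality holds, and U = I_i ∖ W satisfies
--   m |I_j ∖ (W ∪ U)| ≤ max (0, j − m |U|)   for all j,
-- a condition on Z = W ∪ U and u = |U| only.  The inclusion-minimal sets U
-- arising in this way for a given W cover all such I.  By minimality each of them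
-- lies in I'_{mu}, where I' is any set satisfying the condition for Z and u;
-- so at most 2^{mu} of them belong to the same Z and u, which the factor
-- J^{-u} from passing from W to Z outweighs: their expected total weight
-- Σ p^{|U|} is small.  If U = ∅ occurs then W contains all but a small part of
-- every I_j, summation by parts gives Σ_{S ⊆ W} λ_S ≥ 3/4, whereas the
-- expectation of that sum is at most 1/2.  So some W yields a cheap cover by
-- nonempty sets.
module Submission where

open import Defs
open import Data.Empty using (⊥-elim)
open import Data.Fin using (Fin; zero; suc)
open import Data.Fin.Subset
open import Data.Fin.Subset.Properties
open import Data.List using (List; []; _∷_; map; filter; _++_)
open import Data.List.Membership.Propositional using () renaming (_∈_ to _∈ˡ_)
open import Data.List.Membership.Propositional.Properties using (∈-map⁺; ∈-++⁺ˡ; ∈-++⁺ʳ; ∈-filter⁺)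
import Data.List.Relation.Unary.Any as Any
open import Data.Nat as ℕ using (ℕ; NonZero)
import Data.Nat.Properties as ℕ
open import Data.Product using (Σ; ∃-syntax; _×_; _,_; proj₁; proj₂)
open import Data.Rational using (ℚ; 0ℚ; 1ℚ; ½; _+_; _*_; _≤_; _<_; -_; nonNegative)
import Data.Rational as ℚ
import Data.Rational.Properties as ℚ
open import Data.Rational.Solver using (module +-*-Solver)
open import Data.Sum using (_⊎_; inj₁; inj₂; [_,_]′)
open import Data.Unit using (tt)
open import Data.Vec using ([]; _∷_)
open import Data.Vec.Base using (here; there)
open import Function using (_∘_; id)
open import Relation.Binary.PropositionalEquality
  using (_≡_; refl; sym; trans; cong; cong₂; subst; module ≡-Reasoning)
open import Relation.Nullary using (Dec; yes; no; ¬_; contradiction)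
open import Relation.Nullary.Decidable using (_×-dec_; ¬?; from-yes; from-no)

private
  variable
    n : ℕ
    P Q : Set

-- Order and powers of rational numbers, and truncation by a decision

*-monoˡ-≤ : ∀ {a x y} → 0ℚ ≤ a → x ≤ y → a * x ≤ a * y
*-monoˡ-≤ {a} 0≤a = ℚ.*-monoˡ-≤-nonNeg a {{nonNegative 0≤a}}

*-monoʳ-≤ : ∀ {a x y} → 0ℚ ≤ a → x ≤ y → x * a ≤ y * a
*-monoʳ-≤ {a} 0≤a = ℚ.*-monoʳ-≤-nonNeg a {{nonNegative 0≤a}}

+-nonNeg : ∀ {x y} → 0ℚ ≤ x → 0ℚ ≤ y → 0ℚ ≤ x + y
+-nonNeg = ℚ.+-mono-≤

*-nonNeg : ∀ {x y} → 0ℚ ≤ x → 0ℚ ≤ y → 0ℚ ≤ x * y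
*-nonNeg {x} {y} 0≤x 0≤y = subst (_≤ x * y) (ℚ.*-zeroʳ x) (*-monoˡ-≤ 0≤x 0≤y)

x≤x+y : ∀ {x y} → 0ℚ ≤ y → x ≤ x + y
x≤x+y {x} {y} 0≤y = subst (_≤ x + y) (ℚ.+-identityʳ x) (ℚ.+-monoʳ-≤ x 0≤y)

y≤x+y : ∀ {x y} → 0ℚ ≤ x → y ≤ x + y
y≤x+y {x} {y} 0≤x = subst (y ≤_) (ℚ.+-comm y x) (x≤x+y 0≤x)

^ℚ-nonNeg : ∀ {x} k → 0ℚ ≤ x → 0ℚ ≤ x ^ℚ k
^ℚ-nonNeg ℕ.zero    0≤x = ℚ.nonNegative⁻¹ 1ℚ
^ℚ-nonNeg (ℕ.suc k) 0≤x = *-nonNeg 0≤x (^ℚ-nonNeg k 0≤x)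

1≤^ℚ : ∀ {x} k → 1ℚ ≤ x → 1ℚ ≤ x ^ℚ k
1≤^ℚ         ℕ.zero    1≤x = ℚ.≤-refl
1≤^ℚ {x} (ℕ.suc k) 1≤x = ℚ.≤-trans 1≤x
  (subst (_≤ x ^ℚ ℕ.suc k) (ℚ.*-identityʳ x)
    (*-monoˡ-≤ (ℚ.≤-trans (ℚ.nonNegative⁻¹ 1ℚ) 1≤x) (1≤^ℚ k 1≤x)))

^ℚ-*-distribʳ : ∀ x y k → (x * y) ^ℚ k ≡ x ^ℚ k * y ^ℚ k
^ℚ-*-distribʳ x y ℕ.zero    = refl
^ℚ-*-distribʳ x y (ℕ.suc k) = trans (cong (x * y *_) (^ℚ-*-distribʳ x y k))
  (solve 4 (λ x y a b → (x :* y) :* (a :* b) := (x :* a) :* (y :* b)) refl x y (x ^ℚ k) (y ^ℚ k))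
  where open +-*-Solver

when : Dec P → ℚ → ℚ
when (yes _) x = x
when (no _)  x = 0ℚ

when-mono : (d : Dec P) (e : Dec Q) → (P → Q) → ∀ {x} → 0ℚ ≤ x → when d x ≤ when e x
when-mono (yes p) (yes q) f 0≤x = ℚ.≤-refl
when-mono (yes p) (no ¬q) f 0≤x = contradiction (f p) ¬q
when-mono (no ¬p) (yes q) f 0≤x = 0≤x
when-mono (no ¬p) (no ¬q) f 0≤x = ℚ.≤-refl

when-nonNeg : (d : Dec P) → ∀ {x} → 0ℚ ≤ x → 0ℚ ≤ when d x
when-nonNeg (yes _) 0≤x = 0≤x
when-nonNeg (no _)  0≤x = ℚ.≤-refl

when-no : (d : Dec P) → ¬ P → ∀ x → when d x ≡ 0ℚ
when-no (yes p) ¬p x = contradiction p ¬p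
when-no (no _)  ¬p x = refl

when-* : (d : Dec P) → ∀ x y → when d (x * y) ≡ when d x * y
when-* (yes _) x y = refl
when-* (no _)  x y = sym (ℚ.*-zeroˡ y)

-- Sums over the subsets of a set

-- Defined by recursion on the set rather than by filtering all subsets, so that sums over `W`,
-- `∁ W` and `Z` split along the first element in step with the expectation, with no inclusion test
-- in between.
Σ⊆ : Subset n → (Subset n → ℚ) → ℚ
Σ⊆ []            f = f []
Σ⊆ (outside ∷ I) f = Σ⊆ I (f ∘ (outside ∷_))
Σ⊆ (inside ∷ I)  f = Σ⊆ I (f ∘ (outside ∷_)) + Σ⊆ I (f ∘ (inside ∷_))

Σ⊆-mono : (I : Subset n) → ∀ {f g} → (∀ S → S ⊆ I → f S ≤ g S) → Σ⊆ I f ≤ Σ⊆ I g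
Σ⊆-mono []            f≤g = f≤g [] id
Σ⊆-mono (outside ∷ I) f≤g = Σ⊆-mono I (λ S S⊆I → f≤g _ (out⊆ S⊆I))
Σ⊆-mono (inside ∷ I)  f≤g = ℚ.+-mono-≤
  (Σ⊆-mono I (λ S S⊆I → f≤g _ (out⊆ S⊆I))) (Σ⊆-mono I (λ S S⊆I → f≤g _ (in⊆in S⊆I)))

Σ⊆-cong : (I : Subset n) → ∀ {f g} → (∀ S → S ⊆ I → f S ≡ g S) → Σ⊆ I f ≡ Σ⊆ I g
Σ⊆-cong I f≡g = ℚ.≤-antisym
  (Σ⊆-mono I (λ S S⊆I → ℚ.≤-reflexive (f≡g S S⊆I)))
  (Σ⊆-mono I (λ S S⊆I → ℚ.≤-reflexive (sym (f≡g S S⊆I))))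

+-interchange : ∀ a b c d → (a + b) + (c + d) ≡ (a + c) + (b + d)
+-interchange = solve 4 (λ a b c d → (a :+ b) :+ (c :+ d) := (a :+ c) :+ (b :+ d)) refl
  where open +-*-Solver

Σ⊆-+ : (I : Subset n) → ∀ f g → Σ⊆ I (λ S → f S + g S) ≡ Σ⊆ I f + Σ⊆ I g
Σ⊆-+ []            f g = refl
Σ⊆-+ (outside ∷ I) f g = Σ⊆-+ I (f ∘ (outside ∷_)) (g ∘ (outside ∷_))
Σ⊆-+ (inside ∷ I)  f g = trans
  (cong₂ _+_ (Σ⊆-+ I (f ∘ (outside ∷_)) (g ∘ (outside ∷_))) (Σ⊆-+ I (f ∘ (inside ∷_)) (g ∘ (inside ∷_))))
  (+-interchange (Σ⊆ I (f ∘ (outside ∷_))) _ (Σ⊆ I (f ∘ (inside ∷_))) _)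

Σ⊆-*ˡ : (I : Subset n) → ∀ c f → Σ⊆ I (λ S → c * f S) ≡ c * Σ⊆ I f
Σ⊆-*ˡ []            c f = refl
Σ⊆-*ˡ (outside ∷ I) c f = Σ⊆-*ˡ I c _
Σ⊆-*ˡ (inside ∷ I)  c f =
  trans (cong₂ _+_ (Σ⊆-*ˡ I c _) (Σ⊆-*ˡ I c _)) (sym (ℚ.*-distribˡ-+ c _ _))

Σ⊆-zero : (I : Subset n) → Σ⊆ I (λ _ → 0ℚ) ≡ 0ℚ
Σ⊆-zero []            = refl
Σ⊆-zero (outside ∷ I) = Σ⊆-zero I
Σ⊆-zero (inside ∷ I)  = cong₂ _+_ (Σ⊆-zero I) (Σ⊆-zero I)

Σ⊆-nonNeg : (I : Subset n) → ∀ {f} → (∀ S → 0ℚ ≤ f S) → 0ℚ ≤ Σ⊆ I f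
Σ⊆-nonNeg I {f} 0≤f = subst (_≤ Σ⊆ I f) (Σ⊆-zero I) (Σ⊆-mono I (λ S _ → 0≤f S))

Σ⊆-≤-⊤ : (I : Subset n) → ∀ {f} → (∀ S → 0ℚ ≤ f S) → Σ⊆ I f ≤ Σ⊆ ⊤ f
Σ⊆-≤-⊤ []            0≤f = ℚ.≤-refl
Σ⊆-≤-⊤ (outside ∷ I) 0≤f = ℚ.≤-trans (Σ⊆-≤-⊤ I (0≤f ∘ (outside ∷_)))
  (x≤x+y (Σ⊆-nonNeg ⊤ (λ S → 0≤f (inside ∷ S))))
Σ⊆-≤-⊤ (inside ∷ I)  0≤f =
  ℚ.+-mono-≤ (Σ⊆-≤-⊤ I (0≤f ∘ (outside ∷_))) (Σ⊆-≤-⊤ I (0≤f ∘ (inside ∷_)))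

-- The surviving terms belong to the subsets of both `J` and `I`; the remaining subsets of `I` have
-- nonnegative terms. This converts `sumSubsetsOf`, isolates the sets inside `W` in `Σ⊆≤-degree`,
-- and reduces a count to the subsets of a shelter.
Σ⊆-when-≤ : (J I : Subset n) → ∀ {f} → (∀ S → 0ℚ ≤ f S) → Σ⊆ J (λ S → when (S ⊆? I) (f S)) ≤ Σ⊆ I f
Σ⊆-when-≤ []      []      {f} 0≤f = when-mono ([] ⊆? []) (yes tt) (λ _ → tt) (0≤f [])
Σ⊆-when-≤ (j ∷ J) (i ∷ I) {f} 0≤f = split j i
  where
  low : ∀ i → Σ⊆ J (λ S → when (outside ∷ S ⊆? i ∷ I) (f (outside ∷ S))) ≤ Σ⊆ I (f ∘ (outside ∷_))
  low i = ℚ.≤-trans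
    (Σ⊆-mono J (λ S _ → when-mono (outside ∷ S ⊆? i ∷ I) (S ⊆? I) drop-∷-⊆ (0≤f _)))
    (Σ⊆-when-≤ J I (0≤f ∘ (outside ∷_)))
  high : Σ⊆ J (λ S → when (inside ∷ S ⊆? inside ∷ I) (f (inside ∷ S))) ≤ Σ⊆ I (f ∘ (inside ∷_))
  high = ℚ.≤-trans
    (Σ⊆-mono J (λ S _ → when-mono (inside ∷ S ⊆? inside ∷ I) (S ⊆? I) drop-∷-⊆ (0≤f _)))
    (Σ⊆-when-≤ J I (0≤f ∘ (inside ∷_)))
  none : Σ⊆ J (λ S → when (inside ∷ S ⊆? outside ∷ I) (f (inside ∷ S))) ≡ 0ℚ
  none = trans
    (Σ⊆-cong J (λ S _ →
      when-no (inside ∷ S ⊆? outside ∷ I) (λ sub → case-there (sub here)) (f (inside ∷ S))))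
    (Σ⊆-zero J)
    where
    case-there : ¬ (zero ∈ outside ∷ I)
    case-there ()
  lhs₀ = Σ⊆ J (λ S → when (outside ∷ S ⊆? outside ∷ I) (f (outside ∷ S)))
  split : ∀ j i → Σ⊆ (j ∷ J) (λ S → when (S ⊆? i ∷ I) (f S)) ≤ Σ⊆ (i ∷ I) f
  split outside outside = low outside
  split outside inside  = ℚ.≤-trans (low inside) (x≤x+y (Σ⊆-nonNeg I (0≤f ∘ (inside ∷_))))
  split inside  outside = subst (_≤ Σ⊆ I (f ∘ (outside ∷_)))
    (sym (trans (cong (lhs₀ +_) none) (ℚ.+-identityʳ lhs₀))) (low outside)
  split inside  inside  = ℚ.+-mono-≤ (low inside) high

sumSubsets≡Σ⊆ : ∀ n f → sumSubsets n f ≡ Σ⊆ ⊤ f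
sumSubsets≡Σ⊆ ℕ.zero    f = refl
sumSubsets≡Σ⊆ (ℕ.suc n) f = cong₂ _+_ (sumSubsets≡Σ⊆ n _) (sumSubsets≡Σ⊆ n _)

-- Names the summand that is local to the definition of sumSubsetsOf.
sumSubsetsOf-summand : (I : Subset n) (f : Subset n → ℚ) →
  Σ (Subset n → ℚ) λ g → sumSubsetsOf I f ≡ sumSubsets n g
sumSubsetsOf-summand I f = _ , refl

sumSubsetsOf-summand-when : (I : Subset n) (f : Subset n → ℚ) → ∀ S →
  proj₁ (sumSubsetsOf-summand I f) S ≡ when (S ⊆? I) (f S)
sumSubsetsOf-summand-when I f S with S ⊆? I
... | yes _ = refl
... | no  _ = refl

sumSubsetsOf≤Σ⊆ : (I : Subset n) → ∀ {f} → (∀ S → 0ℚ ≤ f S) → sumSubsetsOf I f ≤ Σ⊆ I f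
sumSubsetsOf≤Σ⊆ {n} I {f} 0≤f = begin
  sumSubsetsOf I f                                ≡⟨ proj₂ (sumSubsetsOf-summand I f) ⟩
  sumSubsets n (proj₁ (sumSubsetsOf-summand I f)) ≡⟨ sumSubsets≡Σ⊆ n _ ⟩
  Σ⊆ ⊤ (proj₁ (sumSubsetsOf-summand I f))         ≡⟨ Σ⊆-cong ⊤ (λ S _ → sumSubsetsOf-summand-when I f S) ⟩
  Σ⊆ ⊤ (λ S → when (S ⊆? I) (f S))                ≤⟨ Σ⊆-when-≤ ⊤ I 0≤f ⟩
  Σ⊆ I f                                          ∎
  where open ℚ.≤-Reasoning

-- Listing the subsets of a set

subsetsOf : Subset n → List (Subset n)
subsetsOf []            = [] ∷ []
subsetsOf (outside ∷ I) = map (outside ∷_) (subsetsOf I)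
subsetsOf (inside ∷ I)  = map (outside ∷_) (subsetsOf I) ++ map (inside ∷_) (subsetsOf I)

∈-subsetsOf : {S I : Subset n} → S ⊆ I → S ∈ˡ subsetsOf I
∈-subsetsOf {S = []}          {[]}          S⊆I = Any.here refl
∈-subsetsOf {S = outside ∷ S} {outside ∷ I} S⊆I = ∈-map⁺ _ (∈-subsetsOf (drop-∷-⊆ S⊆I))
∈-subsetsOf {S = inside ∷ S}  {outside ∷ I} S⊆I with S⊆I here
... | ()
∈-subsetsOf {S = outside ∷ S} {inside ∷ I}  S⊆I = ∈-++⁺ˡ (∈-map⁺ _ (∈-subsetsOf (drop-∷-⊆ S⊆I)))
∈-subsetsOf {S = inside ∷ S}  {inside ∷ I}  S⊆I =
  ∈-++⁺ʳ (map (outside ∷_) (subsetsOf I)) (∈-map⁺ _ (∈-subsetsOf (drop-∷-⊆ S⊆I)))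

sum-map-++ : ∀ {A : Set} (f : A → ℚ) xs ys →
  sumℚ (map f (xs ++ ys)) ≡ sumℚ (map f xs) + sumℚ (map f ys)
sum-map-++ f []       ys = sym (ℚ.+-identityˡ _)
sum-map-++ f (x ∷ xs) ys = trans (cong (f x +_) (sum-map-++ f xs ys)) (sym (ℚ.+-assoc (f x) _ _))

sum-map-map : ∀ {A B : Set} (f : B → ℚ) (g : A → B) xs →
  sumℚ (map f (map g xs)) ≡ sumℚ (map (f ∘ g) xs)
sum-map-map f g []       = refl
sum-map-map f g (x ∷ xs) = cong (f (g x) +_) (sum-map-map f g xs)

sum-filter : ∀ {A : Set} {P : A → Set} (P? : ∀ x → Dec (P x)) (f : A → ℚ) xs →
  sumℚ (map f (filter P? xs)) ≡ sumℚ (map (λ x → when (P? x) (f x)) xs)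
sum-filter P? f []       = refl
sum-filter P? f (x ∷ xs) with P? x
... | yes _ = cong (f x +_) (sum-filter P? f xs)
... | no  _ = trans (sum-filter P? f xs) (sym (ℚ.+-identityˡ _))

sum-subsetsOf : (I : Subset n) (f : Subset n → ℚ) → sumℚ (map f (subsetsOf I)) ≡ Σ⊆ I f
sum-subsetsOf []            f = ℚ.+-identityʳ _
sum-subsetsOf (outside ∷ I) f = trans (sum-map-map f _ (subsetsOf I)) (sum-subsetsOf I _)
sum-subsetsOf (inside ∷ I)  f = trans (sum-map-++ f (map (outside ∷_) (subsetsOf I)) _)
  (cong₂ _+_ (trans (sum-map-map f _ (subsetsOf I)) (sum-subsetsOf I _))
             (trans (sum-map-map f _ (subsetsOf I)) (sum-subsetsOf I _)))

-- Random subsets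

module Expectation (a q : ℚ) (0≤a : 0ℚ ≤ a) (0≤q : 0ℚ ≤ q) (a+q≡1 : a + q ≡ 1ℚ) where

  -- Each element is inside independently with probability q.
  𝔼 : ∀ {n} → (Subset n → ℚ) → ℚ
  𝔼 {ℕ.zero}  f = f []
  𝔼 {ℕ.suc n} f = a * 𝔼 (f ∘ (outside ∷_)) + q * 𝔼 (f ∘ (inside ∷_))

  mix : ∀ x → a * x + q * x ≡ x
  mix x = trans (sym (ℚ.*-distribʳ-+ x a q)) (trans (cong (_* x) a+q≡1) (ℚ.*-identityˡ x))

  a≤1 : a ≤ 1ℚ
  a≤1 = subst (a ≤_) a+q≡1 (x≤x+y 0≤q)

  𝔼-mono : ∀ {n} {f g : Subset n → ℚ} → (∀ W → f W ≤ g W) → 𝔼 f ≤ 𝔼 g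
  𝔼-mono {ℕ.zero}  f≤g = f≤g []
  𝔼-mono {ℕ.suc n} f≤g = ℚ.+-mono-≤
    (*-monoˡ-≤ 0≤a (𝔼-mono (f≤g ∘ (outside ∷_)))) (*-monoˡ-≤ 0≤q (𝔼-mono (f≤g ∘ (inside ∷_))))

  𝔼-const : ∀ n c → 𝔼 {n} (λ _ → c) ≡ c
  𝔼-const ℕ.zero    c = refl
  𝔼-const (ℕ.suc n) c = trans (cong (λ x → a * x + q * x) (𝔼-const n c)) (mix c)

  𝔼-nonNeg : ∀ {n} {f : Subset n → ℚ} → (∀ W → 0ℚ ≤ f W) → 0ℚ ≤ 𝔼 f
  𝔼-nonNeg {n} {f} 0≤f = subst (_≤ 𝔼 f) (𝔼-const n 0ℚ) (𝔼-mono 0≤f)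

  𝔼-+ : ∀ {n} (f g : Subset n → ℚ) → 𝔼 (λ W → f W + g W) ≡ 𝔼 f + 𝔼 g
  𝔼-+ {ℕ.zero}  f g = refl
  𝔼-+ {ℕ.suc n} f g = trans (cong₂ (λ x y → a * x + q * y)
    (𝔼-+ (f ∘ (outside ∷_)) (g ∘ (outside ∷_))) (𝔼-+ (f ∘ (inside ∷_)) (g ∘ (inside ∷_))))
    (solve 6 (λ a q x y z w → a :* (x :+ y) :+ q :* (z :+ w) := (a :* x :+ q :* z) :+ (a :* y :+ q :* w))
      refl a q (𝔼 (f ∘ (outside ∷_))) (𝔼 (g ∘ (outside ∷_))) (𝔼 (f ∘ (inside ∷_))) (𝔼 (g ∘ (inside ∷_))))
    where open +-*-Solver

  𝔼-*ˡ : ∀ {n} c (f : Subset n → ℚ) → 𝔼 (λ W → c * f W) ≡ c * 𝔼 f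
  𝔼-*ˡ {ℕ.zero}  c f = refl
  𝔼-*ˡ {ℕ.suc n} c f = trans (cong₂ (λ x y → a * x + q * y) (𝔼-*ˡ c (f ∘ (outside ∷_))) (𝔼-*ˡ c (f ∘ (inside ∷_))))
    (solve 5 (λ a q c x y → a :* (c :* x) :+ q :* (c :* y) := c :* (a :* x :+ q :* y))
      refl a q c (𝔼 (f ∘ (outside ∷_))) (𝔼 (f ∘ (inside ∷_))))
    where open +-*-Solver

  -- Method of conditional expectations: fix the elements one by one, each time entering the branch
  -- with the smaller conditional mean, which is at most the mixture of the two.
  𝔼-attained : ∀ {n} (f : Subset n → ℚ) → ∃[ W ] f W ≤ 𝔼 f
  𝔼-attained {ℕ.zero}  f = [] , ℚ.≤-refl
  𝔼-attained {ℕ.suc n} f with ℚ.≤-total (𝔼 (f ∘ (outside ∷_))) (𝔼 (f ∘ (inside ∷_)))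
  ... | inj₁ o≤i = let W , le = 𝔼-attained (f ∘ (outside ∷_)) in
    outside ∷ W , ℚ.≤-trans le (subst (_≤ 𝔼 f) (mix _) (ℚ.+-monoʳ-≤ (a * 𝔼 (f ∘ (outside ∷_))) (*-monoˡ-≤ 0≤q o≤i)))
  ... | inj₂ i≤o = let W , le = 𝔼-attained (f ∘ (inside ∷_)) in
    inside ∷ W , ℚ.≤-trans le (subst (_≤ 𝔼 f) (mix _) (ℚ.+-monoˡ-≤ (q * 𝔼 (f ∘ (inside ∷_))) (*-monoˡ-≤ 0≤a i≤o)))

  -- Linearity, since a fixed `S` lies in the random set with probability `q ^ℚ ∣ S ∣`. The
  -- induction conditions on the first element: sets avoiding it occur in both branches and
  -- recombine by `mix`, sets containing it pick up one factor `q`.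
  𝔼-Σ⊆ : ∀ {n} (f : Subset n → ℚ) → 𝔼 (λ W → Σ⊆ W f) ≡ Σ⊆ ⊤ (λ S → f S * q ^ℚ ∣ S ∣)
  𝔼-Σ⊆ {ℕ.zero}  f = sym (ℚ.*-identityʳ _)
  𝔼-Σ⊆ {ℕ.suc n} f = begin
    a * 𝔼 (λ W → Σ⊆ W f₀) + q * 𝔼 (λ W → Σ⊆ W f₀ + Σ⊆ W f₁)
      ≡⟨ cong (λ x → a * 𝔼 (λ W → Σ⊆ W f₀) + q * x) (𝔼-+ (λ W → Σ⊆ W f₀) (λ W → Σ⊆ W f₁)) ⟩
    a * 𝔼 (λ W → Σ⊆ W f₀) + q * (𝔼 (λ W → Σ⊆ W f₀) + 𝔼 (λ W → Σ⊆ W f₁))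
      ≡⟨ solve 4 (λ a q x y → a :* x :+ q :* (x :+ y) := (a :* x :+ q :* x) :+ q :* y)
           refl a q (𝔼 (λ W → Σ⊆ W f₀)) (𝔼 (λ W → Σ⊆ W f₁)) ⟩
    (a * 𝔼 (λ W → Σ⊆ W f₀) + q * 𝔼 (λ W → Σ⊆ W f₀)) + q * 𝔼 (λ W → Σ⊆ W f₁)
      ≡⟨ cong₂ _+_ (trans (mix _) (𝔼-Σ⊆ f₀)) (cong (q *_) (𝔼-Σ⊆ f₁)) ⟩
    Σ⊆ ⊤ (λ S → f₀ S * q ^ℚ ∣ S ∣) + q * Σ⊆ ⊤ (λ S → f₁ S * q ^ℚ ∣ S ∣)
      ≡⟨ cong (Σ⊆ ⊤ (λ S → f₀ S * q ^ℚ ∣ S ∣) +_) (trans (sym (Σ⊆-*ˡ ⊤ q (λ S → f₁ S * q ^ℚ ∣ S ∣))) (Σ⊆-cong ⊤ λ S _ →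
           solve 3 (λ q x y → q :* (x :* y) := x :* (q :* y)) refl q (f₁ S) (q ^ℚ ∣ S ∣))) ⟩
    Σ⊆ ⊤ (λ S → f₀ S * q ^ℚ ∣ S ∣) + Σ⊆ ⊤ (λ S → f₁ S * (q * q ^ℚ ∣ S ∣)) ∎
    where
    open ≡-Reasoning
    open +-*-Solver
    f₀ = f ∘ (outside ∷_)
    f₁ = f ∘ (inside ∷_)

  -- Passing from W to Z = W ∪ U multiplies the probability by
  -- (q / a) ^ |U|, at least q ^ |U|.
  𝔼-disjoint-union : ∀ {n} (g : Subset n → Subset n → ℚ) → (∀ W U → 0ℚ ≤ g W U) →
    𝔼 (λ W → Σ⊆ (∁ W) (λ U → g W U * q ^ℚ ∣ U ∣)) ≤ 𝔼 (λ Z → Σ⊆ Z (λ U → g (Z ─ U) U))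
  𝔼-disjoint-union {ℕ.zero}  g 0≤g = ℚ.≤-reflexive (ℚ.*-identityʳ _)
  𝔼-disjoint-union {ℕ.suc n} g 0≤g = begin
    a * 𝔼 (λ W → Σ⊆ (∁ W) (λ U → g₀₀ W U * q ^ℚ ∣ U ∣) + Σ⊆ (∁ W) (λ U → g₀₁ W U * (q * q ^ℚ ∣ U ∣)))
      + q * X g₁₀
      ≡⟨ cong (λ x → a * x + q * X g₁₀) (𝔼-+ (λ W → Σ⊆ (∁ W) (λ U → g₀₀ W U * q ^ℚ ∣ U ∣)) X₀₁) ⟩
    a * (X g₀₀ + 𝔼 X₀₁) + q * X g₁₀
      ≤⟨ ℚ.+-monoˡ-≤ (q * X g₁₀) (*-monoˡ-≤ 0≤a (ℚ.+-monoʳ-≤ (X g₀₀) pull-q)) ⟩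
    a * (X g₀₀ + q * X g₀₁) + q * X g₁₀
      ≤⟨ ℚ.+-mono-≤
           (*-monoˡ-≤ 0≤a (ℚ.+-mono-≤ (𝔼-disjoint-union g₀₀ (λ _ _ → 0≤g _ _))
             (*-monoˡ-≤ 0≤q (𝔼-disjoint-union g₀₁ (λ _ _ → 0≤g _ _)))))
           (*-monoˡ-≤ 0≤q (𝔼-disjoint-union g₁₀ (λ _ _ → 0≤g _ _))) ⟩
    a * (Y g₀₀ + q * Y g₀₁) + q * Y g₁₀
      ≡⟨ cong (_+ q * Y g₁₀) (ℚ.*-distribˡ-+ a (Y g₀₀) _) ⟩
    -- An element of `U` has weight `a * q` on the left, being outside `W` and carrying a factor
    -- `q`, but weight `q` on the right, being inside `Z`. This is where the bound loses, through
    -- `a≤1`.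
    (a * Y g₀₀ + a * (q * Y g₀₁)) + q * Y g₁₀
      ≤⟨ ℚ.+-monoˡ-≤ (q * Y g₁₀) (ℚ.+-monoʳ-≤ (a * Y g₀₀) (*-monoʳ-≤ (*-nonNeg 0≤q 0≤Y₀₁) a≤1)) ⟩
    (a * Y g₀₀ + 1ℚ * (q * Y g₀₁)) + q * Y g₁₀
      ≡⟨ solve 5 (λ a q x y z → (a :* x :+ con 1ℚ :* (q :* y)) :+ q :* z := a :* x :+ q :* (z :+ y))
           refl a q (Y g₀₀) (Y g₀₁) (Y g₁₀) ⟩
    a * Y g₀₀ + q * (Y g₁₀ + Y g₀₁)
      ≡⟨ cong (λ x → a * Y g₀₀ + q * x) (sym (𝔼-+ (λ Z → Σ⊆ Z (λ U → g₁₀ (Z ─ U) U)) (λ Z → Σ⊆ Z (λ U → g₀₁ (Z ─ U) U)))) ⟩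
    a * Y g₀₀ + q * 𝔼 (λ Z → Σ⊆ Z (λ U → g₁₀ (Z ─ U) U) + Σ⊆ Z (λ U → g₀₁ (Z ─ U) U)) ∎
    where
    open ℚ.≤-Reasoning
    open +-*-Solver
    X Y : (Subset n → Subset n → ℚ) → ℚ
    X h = 𝔼 (λ W → Σ⊆ (∁ W) (λ U → h W U * q ^ℚ ∣ U ∣))
    Y h = 𝔼 (λ Z → Σ⊆ Z (λ U → h (Z ─ U) U))
    -- The first element lies in neither set, in `U` only, or in `W` only; disjointness excludes the
    -- fourth case.
    g₀₀ g₀₁ g₁₀ : Subset n → Subset n → ℚ
    g₀₀ W U = g (outside ∷ W) (outside ∷ U)
    g₀₁ W U = g (outside ∷ W) (inside ∷ U)
    g₁₀ W U = g (inside ∷ W) (outside ∷ U)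
    0≤Y₀₁ : 0ℚ ≤ Y g₀₁
    0≤Y₀₁ = 𝔼-nonNeg {f = λ Z → Σ⊆ Z (λ U → g₀₁ (Z ─ U) U)} (λ Z → Σ⊆-nonNeg Z (λ U → 0≤g (outside ∷ (Z ─ U)) (inside ∷ U)))
    X₀₁ : Subset n → ℚ
    X₀₁ W = Σ⊆ (∁ W) (λ U → g₀₁ W U * (q * q ^ℚ ∣ U ∣))
    pull-q : 𝔼 X₀₁ ≤ q * X g₀₁
    pull-q = ℚ.≤-trans
      (𝔼-mono λ W → ℚ.≤-reflexive (trans
        (Σ⊆-cong (∁ W) λ U _ → solve 3 (λ q x y → x :* (q :* y) := q :* (x :* y)) refl q (g₀₁ W U) (q ^ℚ ∣ U ∣))
        (Σ⊆-*ˡ (∁ W) q (λ U → g₀₁ W U * q ^ℚ ∣ U ∣))))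
      (ℚ.≤-reflexive (𝔼-*ˡ q (λ W → Σ⊆ (∁ W) (λ U → g₀₁ W U * q ^ℚ ∣ U ∣))))

-- Fragments

x∈p─q⇒x∉q : ∀ {x : Fin n} (p q : Subset n) → x ∈ p ─ q → x ∉ q
x∈p─q⇒x∉q (s ∷ p) (inside ∷ q)  (there x∈) (there x∈q) = x∈p─q⇒x∉q p q x∈ x∈q
x∈p─q⇒x∉q (s ∷ p) (outside ∷ q) (there x∈) (there x∈q) = x∈p─q⇒x∉q p q x∈ x∈q

∣p∣≡0⇒x∉p : {p : Subset n} {x : Fin n} → ∣ p ∣ ≡ 0 → x ∉ p
∣p∣≡0⇒x∉p {p = inside ∷ p}  ()
∣p∣≡0⇒x∉p {p = outside ∷ p} ∣p∣≡0 (there x∈p) = ∣p∣≡0⇒x∉p ∣p∣≡0 x∈p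

∣p∣+∣q∣≤∣r∣ : {p q r : Subset n} → p ⊆ r → q ⊆ r → (∀ {x} → x ∈ p → x ∉ q) → ∣ p ∣ ℕ.+ ∣ q ∣ ℕ.≤ ∣ r ∣
∣p∣+∣q∣≤∣r∣ {p = []} {[]} {[]} p⊆r q⊆r disj = ℕ.z≤n
∣p∣+∣q∣≤∣r∣ {p = a ∷ p} {b ∷ q} {c ∷ r} p⊆r q⊆r disj = heads a b c p⊆r q⊆r disj
  where
  tails : ∣ p ∣ ℕ.+ ∣ q ∣ ℕ.≤ ∣ r ∣
  tails = ∣p∣+∣q∣≤∣r∣ (drop-∷-⊆ p⊆r) (drop-∷-⊆ q⊆r) (λ x∈p x∈q → disj (there x∈p) (there x∈q))
  heads : ∀ a b c → a ∷ p ⊆ c ∷ r → b ∷ q ⊆ c ∷ r → (∀ {x} → x ∈ a ∷ p → x ∉ b ∷ q) →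
    ∣ a ∷ p ∣ ℕ.+ ∣ b ∷ q ∣ ℕ.≤ ∣ c ∷ r ∣
  heads outside outside c       _   _   _ = ℕ.≤-trans tails (∣p∣≤∣x∷p∣ c r)
  heads outside inside  inside  _   _   _ = ℕ.≤-trans (ℕ.≤-reflexive (ℕ.+-suc ∣ p ∣ ∣ q ∣)) (ℕ.s≤s tails)
  heads inside  outside inside  _   _   _ = ℕ.s≤s tails
  heads inside  inside  c       _   _   d = contradiction here (d here)
  heads outside inside  outside _   q⊆r _ with q⊆r here
  ... | ()
  heads inside  outside outside p⊆r _   _ with p⊆r here
  ... | ()

∣r∣≤∣p∣+∣q∣ : {p q r : Subset n} → (∀ {x} → x ∈ r → x ∈ p ⊎ x ∈ q) → ∣ r ∣ ℕ.≤ ∣ p ∣ ℕ.+ ∣ q ∣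
∣r∣≤∣p∣+∣q∣ {p = p} {q} {r} split = begin
  ∣ r ∣                     ≤⟨ p⊆q⇒∣p∣≤∣q∣ r⊆ ⟩
  ∣ p ∪ (q ─ p) ∣           ≤⟨ ∣p∪q∣≤ p (q ─ p) ⟩
  ∣ p ∣ ℕ.+ ∣ q ─ p ∣       ≤⟨ ℕ.+-monoʳ-≤ ∣ p ∣ (∣p─q∣≤∣p∣ q p) ⟩
  ∣ p ∣ ℕ.+ ∣ q ∣           ∎
  where
  open ℕ.≤-Reasoning
  ∣p∪q∣≤ : ∀ {n} (p q : Subset n) → ∣ p ∪ q ∣ ℕ.≤ ∣ p ∣ ℕ.+ ∣ q ∣
  ∣p∪q∣≤ []            []            = ℕ.z≤n
  ∣p∪q∣≤ (outside ∷ p) (outside ∷ q) = ∣p∪q∣≤ p q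
  ∣p∪q∣≤ (outside ∷ p) (inside ∷ q)  = ℕ.≤-trans (ℕ.s≤s (∣p∪q∣≤ p q)) (ℕ.≤-reflexive (sym (ℕ.+-suc ∣ p ∣ ∣ q ∣)))
  ∣p∪q∣≤ (inside ∷ p)  (b ∷ q)       =
    ℕ.s≤s (ℕ.≤-trans (∣p∪q∣≤ p q) (ℕ.+-monoʳ-≤ ∣ p ∣ (∣p∣≤∣x∷p∣ b q)))
  r⊆ : r ⊆ p ∪ (q ─ p)
  r⊆ {x} x∈r with split x∈r | x ∈? p
  ... | inj₁ x∈p | _       = x∈p∪q⁺ (inj₁ x∈p)
  ... | inj₂ _   | yes x∈p = x∈p∪q⁺ (inj₁ x∈p)
  ... | inj₂ x∈q | no  x∉p = x∈p∪q⁺ (inj₂ (x∈p∧x∉q⇒x∈p─q x∈q x∉p))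

-- Descend from `N`. Where `f` is strictly below the identity, monotonicity keeps it at most the
-- identity one step lower, so the invariant survives until equality occurs, at the latest at 0.
last-fixed-point : (f : ℕ → ℕ) → (∀ {i j} → i ℕ.≤ j → f i ℕ.≤ f j) → ∀ N → f N ℕ.≤ N →
  ∃[ i ] (i ℕ.≤ N × f i ≡ i × (∀ {j} → i ℕ.< j → j ℕ.≤ N → f j ℕ.≤ j))
last-fixed-point f mono ℕ.zero    fN≤N =
  0 , ℕ.z≤n , ℕ.n≤0⇒n≡0 fN≤N , λ 0<j j≤0 → contradiction (ℕ.<-≤-trans 0<j j≤0) λ ()
last-fixed-point f mono (ℕ.suc N) fN≤N with f (ℕ.suc N) ℕ.≟ ℕ.suc N
... | yes eq = ℕ.suc N , ℕ.≤-refl , eq , λ N<j j≤N → contradiction (ℕ.<-≤-trans N<j j≤N) (ℕ.<-irrefl refl)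
... | no ne with last-fixed-point f mono N
                   (ℕ.≤-trans (mono (ℕ.n≤1+n N)) (ℕ.s≤s⁻¹ (ℕ.≤∧≢⇒< fN≤N ne)))
... | i , i≤N , eq , above = i , ℕ.m≤n⇒m≤1+n i≤N , eq , above′
  where
  above′ : ∀ {j} → i ℕ.< j → j ℕ.≤ ℕ.suc N → f j ℕ.≤ j
  above′ i<j j≤1+N with ℕ.m≤n⇒m<n∨m≡n j≤1+N
  ... | inj₁ j<1+N = above i<j (ℕ.s≤s⁻¹ j<1+N)
  ... | inj₂ refl  = fN≤N

module Fragments {n : ℕ} {F : Subset n → Set} (F? : ∀ I → Dec (F I))
  (C : Subset n → ℕ → Subset n)
  (C-mono : ∀ I {i j} → i ℕ.≤ j → C I i ⊆ C I j)
  (C-size : ∀ I j → ∣ C I j ∣ ℕ.≤ j)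
  (C-sub : ∀ I j → C I j ⊆ I)
  (m : ℕ) .{{_ : NonZero m}}
  where

  -- Truncated subtraction supplies the maximum with 0: for `j` up to `m ℕ.* u` the condition says
  -- that `C I j` lies in `Z`. Stopping at `m ℕ.* n` makes the condition decidable; beyond that
  -- index `excess I W j ≤ j` is automatic.
  Near : Subset n → ℕ → Subset n → Set
  Near Z u I = ∀ {j} → j ℕ.< ℕ.suc (m ℕ.* n) → m ℕ.* ∣ C I j ─ Z ∣ ℕ.≤ j ℕ.∸ m ℕ.* u

  Reach : Subset n → ℕ → Set
  Reach Z u = ∃[ I ] (F I × Near Z u I)

  Reach? : ∀ Z u → Dec (Reach Z u)
  Reach? Z u = anySubset? λ I → F? I ×-dec
    ℕ.allUpTo? (λ j → m ℕ.* ∣ C I j ─ Z ∣ ℕ.≤? j ℕ.∸ m ℕ.* u) (ℕ.suc (m ℕ.* n))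

  -- More permissive than the form `C I i ─ W`: besides disjointness from `W`, only the union and
  -- the size of `U` matter. Hence one set `I` can serve as a witness for all fragments with the
  -- same union and size.
  Fragment : Subset n → Subset n → Set
  Fragment W U = U ⊆ ∁ W × Reach (W ∪ U) ∣ U ∣

  Fragment? : ∀ W U → Dec (Fragment W U)
  Fragment? W U = (U ⊆? ∁ W) ×-dec Reach? (W ∪ U) ∣ U ∣

  Minimal : Subset n → Subset n → Set
  Minimal W U = Fragment W U × ¬ (∃[ U′ ] (U′ ⊂ U × Fragment W U′))

  Minimal? : ∀ W U → Dec (Minimal W U)
  Minimal? W U = Fragment? W U ×-dec ¬? (anySubset? λ U′ → (U′ ⊂? U) ×-dec Fragment? W U′)

  Reach-mono : ∀ {Z Z′ u} → Z ⊆ Z′ → Reach Z u → Reach Z′ u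
  Reach-mono {Z} {Z′} Z⊆Z′ (I , FI , near) = I , FI , λ {j} j≤ →
    ℕ.≤-trans (ℕ.*-monoʳ-≤ m (p⊆q⇒∣p∣≤∣q∣ λ x∈ →
      x∈p∧x∉q⇒x∈p─q (p─q⊆p (C I j) Z′ x∈) (λ x∈Z → x∈p─q⇒x∉q (C I j) Z′ x∈ (Z⊆Z′ x∈Z)))) (near j≤)

  ─-mono : ∀ {p q r : Subset n} → p ⊆ q → p ─ r ⊆ q ─ r
  ─-mono {p} {q} {r} p⊆q x∈ = x∈p∧x∉q⇒x∈p─q (p⊆q (p─q⊆p p r x∈)) (x∈p─q⇒x∉q p r x∈)

  excess : Subset n → Subset n → ℕ → ℕ
  excess I W j = m ℕ.* ∣ C I j ─ W ∣

  excess-mono : ∀ I W {i j} → i ℕ.≤ j → excess I W i ℕ.≤ excess I W j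
  excess-mono I W i≤j = ℕ.*-monoʳ-≤ m (p⊆q⇒∣p∣≤∣q∣ (─-mono {r = W} (C-mono I i≤j)))

  -- With k the larger of i and j, the sets `C I j ─ (W ∪ U)` and `U` are disjoint parts of
  -- `C I k ─ W`, and m times the size of the latter is at most k. Subtracting m times the size of
  -- `U` gives nearness.
  fragment-at-fixed-point : ∀ {I W i} → F I → excess I W i ≡ i →
    (∀ {j} → i ℕ.< j → j ℕ.≤ m ℕ.* n → excess I W j ℕ.≤ j) → Fragment W (C I i ─ W)
  fragment-at-fixed-point {I} {W} {i} FI fixed above =
    (λ x∈ → x∉p⇒x∈∁p (x∈p─q⇒x∉q (C I i) W x∈)) , I , FI , near
    where
    U = C I i ─ W
    bound : ∀ {j k} → i ℕ.≤ k → j ℕ.≤ k → excess I W k ℕ.≤ k →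
      m ℕ.* ∣ C I j ─ (W ∪ U) ∣ ℕ.≤ k ℕ.∸ m ℕ.* ∣ U ∣
    bound {j} {k} i≤k j≤k le = ℕ.m+n≤o⇒m≤o∸n _ (ℕ.≤-trans (begin
      m ℕ.* ∣ C I j ─ (W ∪ U) ∣ ℕ.+ m ℕ.* ∣ U ∣ ≡⟨ sym (ℕ.*-distribˡ-+ m _ _) ⟩
      m ℕ.* (∣ C I j ─ (W ∪ U) ∣ ℕ.+ ∣ U ∣)     ≤⟨ ℕ.*-monoʳ-≤ m (∣p∣+∣q∣≤∣r∣ left right disjoint) ⟩
      excess I W k                              ∎) le)
      where
      open ℕ.≤-Reasoning
      left : C I j ─ (W ∪ U) ⊆ C I k ─ W
      left x∈ = x∈p∧x∉q⇒x∈p─q (C-mono I j≤k (p─q⊆p (C I j) (W ∪ U) x∈))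
        (λ x∈W → x∈p─q⇒x∉q (C I j) (W ∪ U) x∈ (x∈p∪q⁺ (inj₁ x∈W)))
      right : U ⊆ C I k ─ W
      right = ─-mono {r = W} (C-mono I i≤k)
      disjoint : ∀ {x} → x ∈ C I j ─ (W ∪ U) → x ∉ U
      disjoint x∈ x∈U = x∈p─q⇒x∉q (C I j) (W ∪ U) x∈ (x∈p∪q⁺ (inj₂ x∈U))
    near : Near (W ∪ U) ∣ U ∣ I
    near {j} j≤N with ℕ.≤-<-connex j i
    -- For k = i the bound is 0, because `fixed` says that m times the size of `U` is exactly i.
    ... | inj₁ j≤i = ℕ.≤-trans (bound ℕ.≤-refl j≤i (ℕ.≤-reflexive fixed))
                       (ℕ.≤-trans (ℕ.≤-reflexive (ℕ.m≤n⇒m∸n≡0 (ℕ.≤-reflexive (sym fixed)))) ℕ.z≤n)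
    ... | inj₂ i<j = bound (ℕ.<⇒≤ i<j) ℕ.≤-refl (above i<j (ℕ.s≤s⁻¹ j≤N))

  fragment-exists : ∀ W {I} → F I → ∃[ U ] (U ⊆ I × Fragment W U)
  fragment-exists W {I} FI =
    -- The descent may start at `m ℕ.* n`, since no set has more than n elements.
    let i , _ , fixed , above = last-fixed-point (excess I W) (excess-mono I W) (m ℕ.* n) (ℕ.*-monoʳ-≤ m (∣p∣≤n (C I (m ℕ.* n) ─ W)))
    in C I i ─ W , (λ x∈ → C-sub I i (p─q⊆p (C I i) W x∈)) , fragment-at-fixed-point FI fixed above

  minimal-below : ∀ W k U → ∣ U ∣ ℕ.≤ k → Fragment W U → ∃[ U₀ ] (U₀ ⊆ U × Minimal W U₀)
  minimal-below W k U ∣U∣≤k frag with anySubset? (λ U′ → (U′ ⊂? U) ×-dec Fragment? W U′)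
  ... | no none = U , id , frag , none
  minimal-below W ℕ.zero U ∣U∣≤k frag | yes (U′ , U′⊂U , frag′) =
    contradiction (ℕ.<-≤-trans (p⊂q⇒∣p∣<∣q∣ U′⊂U) ∣U∣≤k) λ ()
  minimal-below W (ℕ.suc k) U ∣U∣≤k frag | yes (U′ , U′⊂U , frag′) =
    let U₀ , U₀⊆U′ , min = minimal-below W k U′ (ℕ.s≤s⁻¹ (ℕ.<-≤-trans (p⊂q⇒∣p∣<∣q∣ U′⊂U) ∣U∣≤k)) frag′
    in U₀ , (λ x∈ → proj₁ U′⊂U (U₀⊆U′ x∈)) , min

  minimal-exists : ∀ W {I} → F I → ∃[ U ] (U ⊆ I × Minimal W U)
  minimal-exists W FI =
    let U , U⊆I , frag = fragment-exists W FI
        U₀ , U₀⊆U , min = minimal-below W ∣ U ∣ U ℕ.≤-refl frag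
    in U₀ , (λ x∈ → U⊆I (U₀⊆U x∈)) , min

  -- The set `I` need not be the one that produced `U`. Seen from `W = Z ─ U`, its chain has a last
  -- fixed point i at or below u, so `C I i ─ W` is itself a fragment of `W`. It lies in `U`,
  -- because `C I u` lies in `Z`; minimality then forces `U` into it, hence into `C I u`.
  minimal-confined : ∀ {Z U I} → U ⊆ Z → Minimal (Z ─ U) U → F I → Near Z ∣ U ∣ I → U ⊆ C I (m ℕ.* ∣ U ∣)
  minimal-confined {Z} {U} {I} U⊆Z (_ , none) FI near =
    -- The search stops at u to obtain `i≤u`; above u, nearness to `Z` alone gives `excess≤`,
    -- because passing from `Z` to `W` uncovers at most the elements of `U`.
    let i , i≤u , fixed , above = last-fixed-point (excess I W) (excess-mono I W) u (excess≤ ℕ.≤-refl u≤N)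
    in confine i≤u (fragment-at-fixed-point FI fixed λ {j} i<j j≤N →
         [ above i<j , (λ u≤j → excess≤ u≤j j≤N) ]′ (ℕ.≤-total j u))
    where
    W = Z ─ U
    u = m ℕ.* ∣ U ∣
    u≤N : u ℕ.≤ m ℕ.* n
    u≤N = ℕ.*-monoʳ-≤ m (∣p∣≤n U)
    outside-W : ∀ {x} → x ∈ Z → x ∉ W → x ∈ U
    outside-W {x} x∈Z x∉W with x ∈? U
    ... | yes x∈U = x∈U
    ... | no  x∉U = contradiction (x∈p∧x∉q⇒x∈p─q x∈Z x∉U) x∉W
    excess≤ : ∀ {j} → u ℕ.≤ j → j ℕ.≤ m ℕ.* n → excess I W j ℕ.≤ j
    excess≤ {j} u≤j j≤N = begin
      m ℕ.* ∣ C I j ─ W ∣                       ≤⟨ ℕ.*-monoʳ-≤ m (∣r∣≤∣p∣+∣q∣ split) ⟩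
      m ℕ.* (∣ C I j ─ Z ∣ ℕ.+ ∣ U ∣)           ≡⟨ ℕ.*-distribˡ-+ m _ _ ⟩
      m ℕ.* ∣ C I j ─ Z ∣ ℕ.+ u                 ≤⟨ ℕ.+-monoˡ-≤ u (near (ℕ.s≤s j≤N)) ⟩
      (j ℕ.∸ u) ℕ.+ u                           ≡⟨ ℕ.m∸n+n≡m u≤j ⟩
      j                                         ∎
      where
      open ℕ.≤-Reasoning
      split : ∀ {x} → x ∈ C I j ─ W → x ∈ C I j ─ Z ⊎ x ∈ U
      split {x} x∈ with x ∈? Z
      ... | yes x∈Z = inj₂ (outside-W x∈Z (x∈p─q⇒x∉q (C I j) W x∈))
      ... | no  x∉Z = inj₁ (x∈p∧x∉q⇒x∈p─q (p─q⊆p (C I j) W x∈) x∉Z)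
    ∣C─Z∣≡0 : ∣ C I u ─ Z ∣ ≡ 0
    -- Nearness at j = u, where the allowance `u ℕ.∸ u` vanishes.
    ∣C─Z∣≡0 = ℕ.m*n≡0⇒m≡0 _ m (trans (ℕ.*-comm _ m) (ℕ.n≤0⇒n≡0
      (ℕ.≤-trans (near (ℕ.s≤s u≤N)) (ℕ.≤-reflexive (ℕ.n∸n≡0 u)))))
    C⊆Z : C I u ⊆ Z
    C⊆Z {x} x∈C with x ∈? Z
    ... | yes x∈Z = x∈Z
    ... | no  x∉Z = contradiction (x∈p∧x∉q⇒x∈p─q x∈C x∉Z) (∣p∣≡0⇒x∉p ∣C─Z∣≡0)
    confine : ∀ {i} → i ℕ.≤ u → Fragment W (C I i ─ W) → U ⊆ C I u
    confine {i} i≤u frag {x} x∈U with x ∈? (C I i ─ W)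
    ... | yes x∈ = C-mono I i≤u (p─q⊆p (C I i) W x∈)
    -- An element of `U` missed by `C I i ─ W` would make the latter a fragment strictly inside `U`.
    ... | no  x∉ = ⊥-elim (none (C I i ─ W , (inU , x , x∈U , x∉) , frag))
      where
      inU : C I i ─ W ⊆ U
      inU y∈ = outside-W (C⊆Z (C-mono I i≤u (p─q⊆p (C I i) W y∈))) (x∈p─q⇒x∉q (C I i) W y∈)

  -- Depends on Z and u alone: a set containing every minimal fragment U
  -- with |U| = u for which W ∪ U = Z.
  shelter : Subset n → ℕ → Subset n
  shelter Z u with Reach? Z u
  ... | yes (I , _) = C I (m ℕ.* u)
  ... | no  _       = ⊥

  ∣shelter∣≤ : ∀ Z u → ∣ shelter Z u ∣ ℕ.≤ m ℕ.* u
  ∣shelter∣≤ Z u with Reach? Z u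
  ... | yes (I , _) = C-size I (m ℕ.* u)
  ... | no  _       = ℕ.≤-trans (ℕ.≤-reflexive (∣⊥∣≡0 n)) ℕ.z≤n

  -- Whichever set `Reach?` returns, `minimal-confined` applies to it. It must return one, since `U`
  -- is a fragment and so its own witness reaches `Z`.
  minimal⊆shelter : ∀ {Z U} → U ⊆ Z → Minimal (Z ─ U) U → U ⊆ shelter Z ∣ U ∣
  minimal⊆shelter {Z} {U} U⊆Z min with Reach? Z ∣ U ∣
  ... | yes (I , FI , near) = minimal-confined U⊆Z min FI near
  ... | no  unreachable     = contradiction (Reach-mono union⊆Z (proj₂ (proj₁ min))) unreachable
    where
    union⊆Z : (Z ─ U) ∪ U ⊆ Z
    union⊆Z x∈ with x∈p∪q⁻ (Z ─ U) U x∈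
    ... | inj₁ x∈Z─U = p─q⊆p Z U x∈Z─U
    ... | inj₂ x∈U   = U⊆Z x∈U

-- Natural numbers as rationals

fromℕ : ℕ → ℚ
fromℕ ℕ.zero    = 0ℚ
fromℕ (ℕ.suc k) = 1ℚ + fromℕ k

fromℕ-nonNeg : ∀ k → 0ℚ ≤ fromℕ k
fromℕ-nonNeg ℕ.zero    = ℚ.≤-refl
fromℕ-nonNeg (ℕ.suc k) = +-nonNeg (ℚ.nonNegative⁻¹ 1ℚ) (fromℕ-nonNeg k)

fromℕ-mono : ∀ {j k} → j ℕ.≤ k → fromℕ j ≤ fromℕ k
fromℕ-mono {k = k} ℕ.z≤n = fromℕ-nonNeg k
fromℕ-mono (ℕ.s≤s j≤k)   = ℚ.+-monoʳ-≤ 1ℚ (fromℕ-mono j≤k)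

fromℕ-+ : ∀ j k → fromℕ (j ℕ.+ k) ≡ fromℕ j + fromℕ k
fromℕ-+ ℕ.zero    k = sym (ℚ.+-identityˡ _)
fromℕ-+ (ℕ.suc j) k = trans (cong (1ℚ +_) (fromℕ-+ j k)) (sym (ℚ.+-assoc 1ℚ (fromℕ j) (fromℕ k)))

fromℕ-* : ∀ j k → fromℕ (j ℕ.* k) ≡ fromℕ j * fromℕ k
fromℕ-* ℕ.zero    k = sym (ℚ.*-zeroˡ (fromℕ k))
fromℕ-* (ℕ.suc j) k = begin
  fromℕ (k ℕ.+ j ℕ.* k)         ≡⟨ fromℕ-+ k (j ℕ.* k) ⟩
  fromℕ k + fromℕ (j ℕ.* k)     ≡⟨ cong (fromℕ k +_) (fromℕ-* j k) ⟩
  fromℕ k + fromℕ j * fromℕ k   ≡⟨ solve 2 (λ j k → k :+ j :* k := (con 1ℚ :+ j) :* k) refl (fromℕ j) (fromℕ k) ⟩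
  (1ℚ + fromℕ j) * fromℕ k      ∎
  where
  open ≡-Reasoning
  open +-*-Solver

-- Rankings by weight

Σ∈ : Subset n → (Fin n → ℚ) → ℚ
Σ∈ []            w = 0ℚ
Σ∈ (outside ∷ R) w = Σ∈ R (w ∘ suc)
Σ∈ (inside ∷ R)  w = w zero + Σ∈ R (w ∘ suc)

Σ∈-nonNeg : (R : Subset n) → ∀ {w} → (∀ v → 0ℚ ≤ w v) → 0ℚ ≤ Σ∈ R w
Σ∈-nonNeg []            0≤w = ℚ.≤-refl
Σ∈-nonNeg (outside ∷ R) 0≤w = Σ∈-nonNeg R (0≤w ∘ suc)
Σ∈-nonNeg (inside ∷ R)  0≤w = +-nonNeg (0≤w zero) (Σ∈-nonNeg R (0≤w ∘ suc))

Σ∈-remove : {R : Subset n} {v : Fin n} → v ∈ R → ∀ w → Σ∈ R w ≡ w v + Σ∈ (R - v) w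
Σ∈-remove {R = inside ∷ R} here w = cong (λ X → w zero + Σ∈ X (w ∘ suc)) (sym (p─⊥≡p R))
Σ∈-remove {R = outside ∷ R} (there v∈R) w = Σ∈-remove v∈R (w ∘ suc)
Σ∈-remove {R = inside ∷ R} {suc v} (there v∈R) w = trans (cong (w zero +_) (Σ∈-remove v∈R (w ∘ suc)))
  (solve 3 (λ x y z → x :+ (y :+ z) := y :+ (x :+ z)) refl (w zero) (w (suc v)) (Σ∈ (R - v) (w ∘ suc)))
  where open +-*-Solver

Σ∈-term : {R : Subset n} {v : Fin n} → v ∈ R → ∀ {w} → (∀ v → 0ℚ ≤ w v) → w v ≤ Σ∈ R w
Σ∈-term {R = R} {v} v∈R {w} 0≤w =
  subst (w v ≤_) (sym (Σ∈-remove v∈R w)) (x≤x+y (Σ∈-nonNeg (R - v) 0≤w))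

Σ∈-empty : {R : Subset n} → Empty R → ∀ w → Σ∈ R w ≡ 0ℚ
Σ∈-empty {R = []}          empty w = refl
Σ∈-empty {R = outside ∷ R} empty w = Σ∈-empty (drop-∷-Empty empty) (w ∘ suc)
Σ∈-empty {R = inside ∷ R}  empty w = contradiction (zero , here) empty

Σ∈-Σ⊆-comm : (R : Subset n) {m : ℕ} (I : Subset m) (h : Fin n → Subset m → ℚ) →
  Σ∈ R (λ v → Σ⊆ I (h v)) ≡ Σ⊆ I (λ S → Σ∈ R (λ v → h v S))
Σ∈-Σ⊆-comm []            I h = sym (Σ⊆-zero I)
Σ∈-Σ⊆-comm (outside ∷ R) I h = Σ∈-Σ⊆-comm R I (h ∘ suc)
Σ∈-Σ⊆-comm (inside ∷ R)  I h = trans (cong (Σ⊆ I (h zero) +_) (Σ∈-Σ⊆-comm R I (h ∘ suc)))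
  (sym (Σ⊆-+ I (h zero) (λ S → Σ∈ R (λ v → h (suc v) S))))

Σ∈-mono : (R : Subset n) → ∀ {w w′} → (∀ v → w v ≤ w′ v) → Σ∈ R w ≤ Σ∈ R w′
Σ∈-mono []            w≤w′ = ℚ.≤-refl
Σ∈-mono (outside ∷ R) w≤w′ = Σ∈-mono R (w≤w′ ∘ suc)
Σ∈-mono (inside ∷ R)  w≤w′ = ℚ.+-mono-≤ (w≤w′ zero) (Σ∈-mono R (w≤w′ ∘ suc))

Σ∈-when-∈ : (R S : Subset n) → ∀ {c} → 0ℚ ≤ c → Σ∈ R (λ v → when (v ∈? S) c) ≤ fromℕ ∣ S ∣ * c
Σ∈-when-∈ []      []      {c} 0≤c = ℚ.≤-reflexive (sym (ℚ.*-zeroˡ c))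
Σ∈-when-∈ (a ∷ R) (b ∷ S) {c} 0≤c = step a b
  where
  tail : ∀ b → Σ∈ R (λ v → when (suc v ∈? b ∷ S) c) ≤ fromℕ ∣ S ∣ * c
  tail b = ℚ.≤-trans (Σ∈-mono R (λ v → when-mono (suc v ∈? b ∷ S) (v ∈? S) drop-there 0≤c)) (Σ∈-when-∈ R S 0≤c)
  grow : fromℕ ∣ S ∣ * c ≤ (1ℚ + fromℕ ∣ S ∣) * c
  grow = *-monoʳ-≤ {x = fromℕ ∣ S ∣} 0≤c (y≤x+y (ℚ.nonNegative⁻¹ 1ℚ))
  step : ∀ a b → Σ∈ (a ∷ R) (λ v → when (v ∈? b ∷ S) c) ≤ fromℕ ∣ b ∷ S ∣ * c
  step outside outside = tail outside
  step outside inside  = ℚ.≤-trans (tail inside) grow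
  step inside  outside = ℚ.≤-trans (ℚ.≤-reflexive (ℚ.+-identityˡ _)) (tail outside)
  step inside  inside  = ℚ.≤-trans (ℚ.+-monoʳ-≤ c (tail inside)) (ℚ.≤-reflexive
    (solve 2 (λ c s → c :+ s :* c := (con 1ℚ :+ s) :* c) refl c (fromℕ ∣ S ∣)))
    where open +-*-Solver

argmax : (R : Subset n) (w : Fin n → ℚ) → Empty R ⊎ ∃[ v ] (v ∈ R × (∀ {u} → u ∈ R → w u ≤ w v))
argmax []            w = inj₁ λ ()
argmax (outside ∷ R) w with argmax R (w ∘ suc)
... | inj₁ empty           = inj₁ λ { (suc v , there v∈R) → empty (v , v∈R) }
... | inj₂ (v , v∈R , max) = inj₂ (suc v , there v∈R , λ { (there u∈R) → max u∈R })
argmax (inside ∷ R)  w with argmax R (w ∘ suc)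
... | inj₁ empty           = inj₂ (zero , here , λ { here → ℚ.≤-refl ; (there u∈R) → contradiction (_ , u∈R) empty })
... | inj₂ (v , v∈R , max) with ℚ.≤-total (w zero) (w (suc v))
...   | inj₁ z≤v = inj₂ (suc v , there v∈R , λ { here → z≤v ; (there u∈R) → max u∈R })
...   | inj₂ v≤z = inj₂ (zero , here , λ { here → ℚ.≤-refl ; (there u∈R) → ℚ.≤-trans (max u∈R) v≤z })

-- A chain whose j-th member consists of the j heaviest elements of R.
-- The offset c makes the last field, a summation by parts, inductive.
record Ranking (k : ℕ) (R : Subset n) (w : Fin n → ℚ) : Set where
  field
    top      : ℕ → Subset n
    top-step : ∀ j → top j ⊆ top (ℕ.suc j)
    ∣top∣≤   : ∀ j → ∣ top j ∣ ℕ.≤ j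
    top⊆     : ∀ j → top j ⊆ R
    abel     : ∀ m c W {M} → 0ℚ ≤ M → (∀ {v} → v ∈ R → w v ≤ M) →
      (∀ {j} → j ℕ.≤ k → m ℕ.* ∣ top j ─ W ∣ ℕ.≤ j ℕ.+ c) →
      fromℕ m * Σ∈ (R ─ W) w ≤ Σ∈ R w + fromℕ c * M

  top-mono : ∀ {i j} → i ℕ.≤ j → top i ⊆ top j
  top-mono {i} i≤j = go (ℕ.≤⇒≤′ i≤j)
    where
    go : ∀ {j} → i ℕ.≤′ j → top i ⊆ top j
    go ℕ.≤′-refl          = id
    go (ℕ.≤′-step i≤′j) x∈ = top-step _ (go i≤′j x∈)

empty-ranking : ∀ k {R : Subset n} {w} → Empty R → Ranking k R w
empty-ranking {n} k {R} {w} empty = record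
  { top      = λ _ → ⊥
  ; top-step = λ _ → id
  ; ∣top∣≤   = λ _ → ℕ.≤-trans (ℕ.≤-reflexive (∣⊥∣≡0 n)) ℕ.z≤n
  ; top⊆     = λ _ → ⊥⊆
  ; abel     = λ m c W {M} 0≤M _ _ → begin
      fromℕ m * Σ∈ (R ─ W) w ≡⟨ cong (fromℕ m *_) (Σ∈-empty (λ (x , x∈) → empty (x , p─q⊆p R W x∈)) w) ⟩
      fromℕ m * 0ℚ           ≡⟨ ℚ.*-zeroʳ (fromℕ m) ⟩
      0ℚ                     ≤⟨ *-nonNeg (fromℕ-nonNeg c) 0≤M ⟩
      fromℕ c * M            ≡⟨ sym (ℚ.+-identityˡ _) ⟩
      0ℚ + fromℕ c * M       ≡⟨ cong (_+ fromℕ c * M) (sym (Σ∈-empty empty w)) ⟩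
      Σ∈ R w + fromℕ c * M   ∎
  }
  where open ℚ.≤-Reasoning

remove-outside : {R : Subset n} {v : Fin n} → v ∉ R → R - v ≡ R
remove-outside {R = R} {v} v∉R = ⊆-antisym (p─q⊆p R ⁅ v ⁆) λ x∈R →
  x∈p∧x≢y⇒x∈p-y x∈R λ { refl → v∉R x∈R }

-- Put the heaviest element `v` in front and apply summation by parts to the rest with the bound
-- `w v`. The index shift raises the offset to c + 1; if `v` is outside `W`, it uses up m of this.
-- In both cases the total is the sum over `R - v` plus c + 1 copies of `w v`: one copy completes
-- the sum over `R`, and the others are at most c times `M`.
cons-ranking : ∀ {k} {R : Subset n} {w} {v} → (∀ u → 0ℚ ≤ w u) → v ∈ R →
  (∀ {u} → u ∈ R → w u ≤ w v) → Ranking k (R - v) w → Ranking (ℕ.suc k) R w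
cons-ranking {n} {k} {R} {w} {v} 0≤w v∈R max ranking = record
  { top      = top
  ; top-step = step
  ; ∣top∣≤   = size
  ; top⊆     = sub
  ; abel     = abel
  }
  where
  module T = Ranking ranking
  top : ℕ → Subset n
  top ℕ.zero    = ⊥
  top (ℕ.suc j) = ⁅ v ⁆ ∪ T.top j
  step : ∀ j → top j ⊆ top (ℕ.suc j)
  step ℕ.zero    x∈ = contradiction x∈ ∉⊥
  step (ℕ.suc j) x∈ with x∈p∪q⁻ ⁅ v ⁆ (T.top j) x∈
  ... | inj₁ x∈v = x∈p∪q⁺ (inj₁ x∈v)
  ... | inj₂ x∈T = x∈p∪q⁺ (inj₂ (T.top-step j x∈T))
  size : ∀ j → ∣ top j ∣ ℕ.≤ j
  size ℕ.zero    = ℕ.≤-reflexive (∣⊥∣≡0 n)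
  size (ℕ.suc j) = ℕ.≤-trans (∣r∣≤∣p∣+∣q∣ (x∈p∪q⁻ ⁅ v ⁆ (T.top j)))
    (ℕ.+-mono-≤ (ℕ.≤-reflexive (∣⁅x⁆∣≡1 v)) (T.∣top∣≤ j))
  sub : ∀ j → top j ⊆ R
  sub ℕ.zero    x∈ = contradiction x∈ ∉⊥
  sub (ℕ.suc j) x∈ with x∈p∪q⁻ ⁅ v ⁆ (T.top j) x∈
  ... | inj₁ x∈v = subst (_∈ R) (sym (x∈⁅y⁆⇒x≡y v x∈v)) v∈R
  ... | inj₂ x∈T = p─q⊆p R ⁅ v ⁆ (T.top⊆ j x∈T)
  open ℚ.≤-Reasoning
  open +-*-Solver
  R′ = Σ∈ (R - v) w
  abel : ∀ m c W {M} → 0ℚ ≤ M → (∀ {v} → v ∈ R → w v ≤ M) →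
    (∀ {j} → j ℕ.≤ ℕ.suc k → m ℕ.* ∣ top j ─ W ∣ ℕ.≤ j ℕ.+ c) →
    fromℕ m * Σ∈ (R ─ W) w ≤ Σ∈ R w + fromℕ c * M
  abel m c W {M} 0≤M w≤M sparse with v ∈? W
  ... | yes v∈W = begin
    fromℕ m * Σ∈ (R ─ W) w
      ≡⟨ cong (λ X → fromℕ m * Σ∈ X w) (trans (sym (remove-outside v∉R─W)) (p─q─r≡p─r─q R W ⁅ v ⁆)) ⟩
    fromℕ m * Σ∈ ((R - v) ─ W) w
      ≤⟨ T.abel m (ℕ.suc c) W (0≤w v) (λ u∈ → max (p─q⊆p R ⁅ v ⁆ u∈)) sparse′ ⟩
    R′ + (1ℚ + fromℕ c) * w v
      ≡⟨ solve 3 (λ r c x → r :+ (con 1ℚ :+ c) :* x := (x :+ r) :+ c :* x) refl R′ (fromℕ c) (w v) ⟩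
    (w v + R′) + fromℕ c * w v
      ≡⟨ cong (_+ fromℕ c * w v) (sym (Σ∈-remove v∈R w)) ⟩
    Σ∈ R w + fromℕ c * w v
      ≤⟨ ℚ.+-monoʳ-≤ (Σ∈ R w) (*-monoˡ-≤ (fromℕ-nonNeg c) (w≤M v∈R)) ⟩
    Σ∈ R w + fromℕ c * M ∎
    where
    v∉R─W : v ∉ R ─ W
    v∉R─W v∈ = x∈p─q⇒x∉q R W v∈ v∈W
    sparse′ : ∀ {j} → j ℕ.≤ k → m ℕ.* ∣ T.top j ─ W ∣ ℕ.≤ j ℕ.+ ℕ.suc c
    sparse′ {j} j≤k = ℕ.≤-trans (ℕ.*-monoʳ-≤ m (p⊆q⇒∣p∣≤∣q∣ {q = top (ℕ.suc j) ─ W} λ x∈ →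
        x∈p∧x∉q⇒x∈p─q (x∈p∪q⁺ (inj₂ (p─q⊆p (T.top j) W x∈))) (x∈p─q⇒x∉q (T.top j) W x∈)))
      (ℕ.≤-trans (sparse (ℕ.s≤s j≤k)) (ℕ.≤-reflexive (sym (ℕ.+-suc j c))))
  ... | no v∉W = begin
    fromℕ m * Σ∈ (R ─ W) w
      ≡⟨ cong (fromℕ m *_) (trans (Σ∈-remove (x∈p∧x∉q⇒x∈p─q v∈R v∉W) w)
           (cong (λ X → w v + Σ∈ X w) (p─q─r≡p─r─q R W ⁅ v ⁆))) ⟩
    fromℕ m * (w v + Σ∈ ((R - v) ─ W) w)
      ≡⟨ ℚ.*-distribˡ-+ (fromℕ m) (w v) _ ⟩
    fromℕ m * w v + fromℕ m * Σ∈ ((R - v) ─ W) w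
      ≤⟨ ℚ.+-monoʳ-≤ (fromℕ m * w v)
           (T.abel m c′ W (0≤w v) (λ u∈ → max (p─q⊆p R ⁅ v ⁆ u∈)) sparse′) ⟩
    fromℕ m * w v + (R′ + fromℕ c′ * w v)
      ≡⟨ solve 4 (λ m x r c → m :* x :+ (r :+ c :* x) := r :+ (m :+ c) :* x) refl (fromℕ m) (w v) R′ (fromℕ c′) ⟩
    R′ + (fromℕ m + fromℕ c′) * w v
      ≡⟨ cong (λ x → R′ + x * w v) (trans (sym (fromℕ-+ m c′)) (cong fromℕ (ℕ.m+[n∸m]≡n m≤1+c))) ⟩
    R′ + (1ℚ + fromℕ c) * w v
      ≡⟨ solve 3 (λ r c x → r :+ (con 1ℚ :+ c) :* x := (x :+ r) :+ c :* x) refl R′ (fromℕ c) (w v) ⟩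
    (w v + R′) + fromℕ c * w v
      ≡⟨ cong (_+ fromℕ c * w v) (sym (Σ∈-remove v∈R w)) ⟩
    Σ∈ R w + fromℕ c * w v
      ≤⟨ ℚ.+-monoʳ-≤ (Σ∈ R w) (*-monoˡ-≤ (fromℕ-nonNeg c) (w≤M v∈R)) ⟩
    Σ∈ R w + fromℕ c * M ∎
    where
    c′ = ℕ.suc c ℕ.∸ m
    count : ∀ {j} → j ℕ.≤ k → m ℕ.* ∣ T.top j ─ W ∣ ℕ.+ m ℕ.≤ j ℕ.+ ℕ.suc c
    count {j} j≤k = ℕ.≤-trans (ℕ.≤-trans (ℕ.≤-reflexive (trans (ℕ.+-comm _ m) (sym (ℕ.*-suc m _))))
      (ℕ.*-monoʳ-≤ m (subst (λ s → s ℕ.+ ∣ T.top j ─ W ∣ ℕ.≤ ∣ top (ℕ.suc j) ─ W ∣) (∣⁅x⁆∣≡1 v)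
        (∣p∣+∣q∣≤∣r∣ {p = ⁅ v ⁆} {T.top j ─ W} {top (ℕ.suc j) ─ W} left right disjoint))))
      (ℕ.≤-trans (sparse (ℕ.s≤s j≤k)) (ℕ.≤-reflexive (sym (ℕ.+-suc j c))))
      where
      left : ⁅ v ⁆ ⊆ top (ℕ.suc j) ─ W
      left x∈ = x∈p∧x∉q⇒x∈p─q (x∈p∪q⁺ (inj₁ x∈)) (subst (_∉ W) (sym (x∈⁅y⁆⇒x≡y v x∈)) v∉W)
      right : T.top j ─ W ⊆ top (ℕ.suc j) ─ W
      right x∈ = x∈p∧x∉q⇒x∈p─q (x∈p∪q⁺ (inj₂ (p─q⊆p (T.top j) W x∈))) (x∈p─q⇒x∉q (T.top j) W x∈)
      disjoint : ∀ {x} → x ∈ ⁅ v ⁆ → x ∉ T.top j ─ W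
      disjoint x∈v x∈T = x∈p─q⇒x∉q R ⁅ v ⁆ (T.top⊆ j (p─q⊆p (T.top j) W x∈T)) x∈v
    -- The case j = 0 of `count`; it makes the truncated subtraction in `c′` exact.
    m≤1+c : m ℕ.≤ ℕ.suc c
    m≤1+c = ℕ.m+n≤o⇒n≤o _ (count ℕ.z≤n)
    sparse′ : ∀ {j} → j ℕ.≤ k → m ℕ.* ∣ T.top j ─ W ∣ ℕ.≤ j ℕ.+ c′
    sparse′ {j} j≤k = ℕ.≤-trans (ℕ.m+n≤o⇒m≤o∸n _ (count j≤k)) (ℕ.≤-reflexive (ℕ.+-∸-assoc j m≤1+c))

rank : ∀ k (R : Subset n) w → (∀ v → 0ℚ ≤ w v) → ∣ R ∣ ℕ.≤ k → Ranking k R w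
rank k R w 0≤w ∣R∣≤k with argmax R w
rank k         R w 0≤w ∣R∣≤k | inj₁ empty           = empty-ranking k empty
rank ℕ.zero    R w 0≤w ∣R∣≤k | inj₂ (v , v∈R , max) =
  contradiction (ℕ.<-≤-trans (x∈p⇒∣p-x∣<∣p∣ v∈R) ∣R∣≤k) λ ()
rank (ℕ.suc k) R w 0≤w ∣R∣≤k | inj₂ (v , v∈R , max) =
  cons-ranking 0≤w v∈R max (rank k (R - v) w 0≤w (ℕ.s≤s⁻¹ (ℕ.<-≤-trans (x∈p⇒∣p-x∣<∣p∣ v∈R) ∣R∣≤k)))

-- Degrees and the weight inside a set

module Degrees (r : ℕ) (λf : Subset n → ℚ) (0≤λ : ∀ S → 0ℚ ≤ λf S)
  (λ-rank : ∀ S → ∣ S ∣ ℕ.> r → λf S ≡ 0ℚ) where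

  degree : Subset n → Fin n → ℚ
  degree I v = Σ⊆ I (λ S → when (v ∈? S) (λf S))

  degree-nonNeg : ∀ I v → 0ℚ ≤ degree I v
  degree-nonNeg I v = Σ⊆-nonNeg I (λ S → when-nonNeg (v ∈? S) (0≤λ S))

  degree≤ : ∀ I v → degree I v ≤ Σ⊆ I λf
  degree≤ I v = Σ⊆-mono I (λ S _ → when-≤ (v ∈? S) (0≤λ S))
    where
    when-≤ : ∀ {P : Set} (d : Dec P) {x} → 0ℚ ≤ x → when d x ≤ x
    when-≤ (yes _) 0≤x = ℚ.≤-refl
    when-≤ (no _)  0≤x = 0≤x

  -- Double counting: `S` contributes its weight once per vertex, and a set with more than `r`
  -- vertices has weight 0.
  Σ-degree≤ : ∀ I → Σ∈ I (degree I) ≤ fromℕ r * Σ⊆ I λf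
  Σ-degree≤ I = begin
    Σ∈ I (degree I)                                  ≡⟨ Σ∈-Σ⊆-comm I I (λ v S → when (v ∈? S) (λf S)) ⟩
    Σ⊆ I (λ S → Σ∈ I (λ v → when (v ∈? S) (λf S)))   ≤⟨ Σ⊆-mono I (λ S _ → per-set S) ⟩
    Σ⊆ I (λ S → fromℕ r * λf S)                      ≡⟨ Σ⊆-*ˡ I (fromℕ r) λf ⟩
    fromℕ r * Σ⊆ I λf                                ∎
    where
    open ℚ.≤-Reasoning
    bounded : ∀ S → fromℕ ∣ S ∣ * λf S ≤ fromℕ r * λf S
    bounded S with ∣ S ∣ ℕ.≤? r
    ... | yes ∣S∣≤r = *-monoʳ-≤ (0≤λ S) (fromℕ-mono ∣S∣≤r)
    ... | no  ∣S∣≰r rewrite λ-rank S (ℕ.≰⇒> ∣S∣≰r) =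
      ℚ.≤-reflexive (trans (ℚ.*-zeroʳ (fromℕ ∣ S ∣)) (sym (ℚ.*-zeroʳ (fromℕ r))))
    per-set : ∀ S → Σ∈ I (λ v → when (v ∈? S) (λf S)) ≤ fromℕ r * λf S
    per-set S = ℚ.≤-trans (Σ∈-when-∈ I S (0≤λ S)) (bounded S)

  -- A subset of `I` either lies in `W` or contains a vertex of `I ─ W`, whose degree then accounts
  -- for it.
  Σ⊆≤-degree : ∀ I W → Σ⊆ I λf ≤ Σ∈ (I ─ W) (degree I) + Σ⊆ W λf
  Σ⊆≤-degree I W = begin
    Σ⊆ I λf
      ≤⟨ Σ⊆-mono I per-set ⟩
    Σ⊆ I (λ S → hit S + when (S ⊆? W) (λf S))
      ≡⟨ Σ⊆-+ I hit (λ S → when (S ⊆? W) (λf S)) ⟩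
    Σ⊆ I hit + Σ⊆ I (λ S → when (S ⊆? W) (λf S))
      ≤⟨ ℚ.+-monoʳ-≤ (Σ⊆ I hit) (Σ⊆-when-≤ I W 0≤λ) ⟩
    Σ⊆ I hit + Σ⊆ W λf
      ≡⟨ cong (_+ Σ⊆ W λf) (sym (Σ∈-Σ⊆-comm (I ─ W) I (λ v S → when (v ∈? S) (λf S)))) ⟩
    Σ∈ (I ─ W) (degree I) + Σ⊆ W λf ∎
    where
    open ℚ.≤-Reasoning
    hit : Subset n → ℚ
    hit S = Σ∈ (I ─ W) (λ v → when (v ∈? S) (λf S))
    0≤hit : ∀ S → 0ℚ ≤ hit S
    0≤hit S = Σ∈-nonNeg (I ─ W) (λ v → when-nonNeg (v ∈? S) (0≤λ S))
    when-yes : ∀ {P : Set} (d : Dec P) → P → ∀ x → when d x ≡ x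
    when-yes (yes _) p x = refl
    when-yes (no ¬p) p x = contradiction p ¬p
    per-set : ∀ S → S ⊆ I → λf S ≤ hit S + when (S ⊆? W) (λf S)
    per-set S S⊆I with nonempty? (S ─ W)
    ... | yes (v , v∈) = ℚ.≤-trans
      (ℚ.≤-trans (ℚ.≤-reflexive (sym (when-yes (v ∈? S) (p─q⊆p S W v∈) (λf S))))
        (Σ∈-term {R = I ─ W} (x∈p∧x∉q⇒x∈p─q (S⊆I (p─q⊆p S W v∈)) (x∈p─q⇒x∉q S W v∈))
          (λ v → when-nonNeg (v ∈? S) (0≤λ S))))
      (x≤x+y (when-nonNeg (S ⊆? W) (0≤λ S)))
    ... | no empty = ℚ.≤-trans (ℚ.≤-reflexive (sym (when-yes (S ⊆? W) S⊆W (λf S)))) (y≤x+y (0≤hit S))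
      where
      S⊆W : S ⊆ W
      S⊆W {x} x∈S with x ∈? W
      ... | yes x∈W = x∈W
      ... | no  x∉W = contradiction (x , x∈p∧x∉q⇒x∈p─q x∈S x∉W) empty

  ranking : ∀ I → Ranking n I (degree I)
  ranking I = rank n I (degree I) (degree-nonNeg I) (∣p∣≤n I)

  module _ .{{_ : NonZero r}} where

    -- Summation by parts with offset 0 bounds 4r times the degree sum over `I ─ W` by the full
    -- degree sum, hence by r times `L`. At most a quarter of `L` is thus lost outside `W`, which
    -- explains the choice m = 4r. The inequality is kept multiplied by 4r, so that no division
    -- occurs.
    weight-of-near-superset : ∀ {I W} → 1ℚ ≤ Σ⊆ I λf →
      (∀ {j} → j ℕ.≤ n → 4 ℕ.* r ℕ.* ∣ Ranking.top (ranking I) j ─ W ∣ ℕ.≤ j) →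
      fromℕ 3 ≤ fromℕ 4 * Σ⊆ W λf
    weight-of-near-superset {I} {W} 1≤L sparse = ℚ.≤-trans
      (subst (_≤ fromℕ 3 * L) (ℚ.*-identityʳ (fromℕ 3)) (*-monoˡ-≤ (fromℕ-nonNeg 3) 1≤L))
      (cancel-L (ℚ.+-monoʳ-≤ (- L) (ℚ.*-cancelˡ-≤-pos ρ {{positive}} main)))
      where
      open ℚ.≤-Reasoning
      open +-*-Solver
      L = Σ⊆ I λf
      B = Σ⊆ W λf
      D = Σ∈ (I ─ W) (degree I)
      ρ = fromℕ r
      positive : ℚ.Positive ρ
      positive = pos r
        where
        pos : ∀ r .{{_ : NonZero r}} → ℚ.Positive (fromℕ r)
        pos (ℕ.suc r) = ℚ.pos+nonNeg⇒pos 1ℚ (fromℕ r) {{nonNegative (fromℕ-nonNeg r)}}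
      4D≤L : fromℕ (4 ℕ.* r) * D ≤ ρ * L
      4D≤L = begin
        fromℕ (4 ℕ.* r) * D
          ≤⟨ Ranking.abel (ranking I) (4 ℕ.* r) 0 W (Σ⊆-nonNeg I 0≤λ) (λ {v} _ → degree≤ I v)
               (λ j≤n → ℕ.≤-trans (sparse j≤n) (ℕ.m≤m+n _ 0)) ⟩
        Σ∈ I (degree I) + 0ℚ * L
          ≡⟨ solve 2 (λ x l → x :+ con 0ℚ :* l := x) refl (Σ∈ I (degree I)) L ⟩
        Σ∈ I (degree I)
          ≤⟨ Σ-degree≤ I ⟩
        ρ * L ∎
      main : ρ * (fromℕ 4 * L) ≤ ρ * (L + fromℕ 4 * B)
      main = begin
        ρ * (fromℕ 4 * L)                   ≤⟨ *-monoˡ-≤ (fromℕ-nonNeg r)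
                                                (*-monoˡ-≤ (fromℕ-nonNeg 4) (Σ⊆≤-degree I W)) ⟩
        ρ * (fromℕ 4 * (D + B))             ≡⟨ solve 4 (λ r f d b → r :* (f :* (d :+ b)) := (f :* r) :* d :+ r :* (f :* b))
                                                refl ρ (fromℕ 4) D B ⟩
        (fromℕ 4 * ρ) * D + ρ * (fromℕ 4 * B) ≡⟨ cong (λ x → x * D + ρ * (fromℕ 4 * B)) (sym (fromℕ-* 4 r)) ⟩
        fromℕ (4 ℕ.* r) * D + ρ * (fromℕ 4 * B) ≤⟨ ℚ.+-monoˡ-≤ (ρ * (fromℕ 4 * B)) 4D≤L ⟩
        ρ * L + ρ * (fromℕ 4 * B)           ≡⟨ sym (ℚ.*-distribˡ-+ ρ L _) ⟩
        ρ * (L + fromℕ 4 * B)               ∎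
      cancel-L : - L + fromℕ 4 * L ≤ - L + (L + fromℕ 4 * B) → fromℕ 3 * L ≤ fromℕ 4 * B
      cancel-L le = begin
        fromℕ 3 * L               ≡⟨ solve 1 (λ l → con (fromℕ 3) :* l := (:- l) :+ con (fromℕ 4) :* l) refl L ⟩
        - L + fromℕ 4 * L         ≤⟨ le ⟩
        - L + (L + fromℕ 4 * B)   ≡⟨ solve 2 (λ l b → (:- l) :+ (l :+ b) := b) refl L (fromℕ 4 * B) ⟩
        fromℕ 4 * B               ∎

-- Powers, counting subsets, and a geometric series

^ℚ-+ : ∀ x j k → x ^ℚ (j ℕ.+ k) ≡ x ^ℚ j * x ^ℚ k
^ℚ-+ x ℕ.zero    k = sym (ℚ.*-identityˡ _)
^ℚ-+ x (ℕ.suc j) k = trans (cong (x *_) (^ℚ-+ x j k)) (sym (ℚ.*-assoc x (x ^ℚ j) (x ^ℚ k)))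

^ℚ-* : ∀ x j k → x ^ℚ (j ℕ.* k) ≡ (x ^ℚ k) ^ℚ j
^ℚ-* x ℕ.zero    k = refl
^ℚ-* x (ℕ.suc j) k = trans (^ℚ-+ x k (j ℕ.* k)) (cong (x ^ℚ k *_) (^ℚ-* x j k))

1^ℚ : ∀ k → 1ℚ ^ℚ k ≡ 1ℚ
1^ℚ ℕ.zero    = refl
1^ℚ (ℕ.suc k) = trans (ℚ.*-identityˡ _) (1^ℚ k)

^ℚ-mono : ∀ {x j k} → 1ℚ ≤ x → j ℕ.≤ k → x ^ℚ j ≤ x ^ℚ k
^ℚ-mono {k = k} 1≤x ℕ.z≤n       = 1≤^ℚ k 1≤x
^ℚ-mono         1≤x (ℕ.s≤s j≤k) = *-monoˡ-≤ (ℚ.≤-trans (ℚ.nonNegative⁻¹ 1ℚ) 1≤x) (^ℚ-mono 1≤x j≤k)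

2ℚ : ℚ
2ℚ = 1ℚ + 1ℚ

1≤2 : 1ℚ ≤ 2ℚ
1≤2 = from-yes (1ℚ ℚ.≤? 2ℚ)

Σ⊆-const : (I : Subset n) → ∀ c → Σ⊆ I (λ _ → c) ≡ 2ℚ ^ℚ ∣ I ∣ * c
Σ⊆-const []            c = sym (ℚ.*-identityˡ c)
Σ⊆-const (outside ∷ I) c = Σ⊆-const I c
Σ⊆-const (inside ∷ I)  c = trans (cong₂ _+_ (Σ⊆-const I c) (Σ⊆-const I c))
  (solve 2 (λ x c → x :* c :+ x :* c := (con 2ℚ :* x) :* c) refl (2ℚ ^ℚ ∣ I ∣) c)
  where open +-*-Solver

Σ< : ℕ → (ℕ → ℚ) → ℚ
Σ< ℕ.zero    h = 0ℚ
Σ< (ℕ.suc k) h = Σ< k h + h k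

Σ<-nonNeg : ∀ k {h} → (∀ i → 0ℚ ≤ h i) → 0ℚ ≤ Σ< k h
Σ<-nonNeg ℕ.zero    0≤h = ℚ.≤-refl
Σ<-nonNeg (ℕ.suc k) 0≤h = +-nonNeg (Σ<-nonNeg k 0≤h) (0≤h k)

Σ<-mono : ∀ k {h h′} → (∀ i → h i ≤ h′ i) → Σ< k h ≤ Σ< k h′
Σ<-mono ℕ.zero    h≤h′ = ℚ.≤-refl
Σ<-mono (ℕ.suc k) h≤h′ = ℚ.+-mono-≤ (Σ<-mono k h≤h′) (h≤h′ k)

Σ<-term : ∀ {i k h} → i ℕ.< k → (∀ i → 0ℚ ≤ h i) → h i ≤ Σ< k h
Σ<-term {i} {ℕ.suc k} {h} i<1+k 0≤h with ℕ.m≤n⇒m<n∨m≡n (ℕ.s≤s⁻¹ i<1+k)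
... | inj₁ i<k  = ℚ.≤-trans (Σ<-term i<k 0≤h) (x≤x+y (0≤h k))
... | inj₂ refl = y≤x+y (Σ<-nonNeg k 0≤h)

Σ⊆-Σ<-comm : (I : Subset n) → ∀ k (h : ℕ → Subset n → ℚ) →
  Σ⊆ I (λ S → Σ< k (λ i → h i S)) ≡ Σ< k (λ i → Σ⊆ I (h i))
Σ⊆-Σ<-comm I ℕ.zero    h = Σ⊆-zero I
Σ⊆-Σ<-comm I (ℕ.suc k) h =
  trans (Σ⊆-+ I (λ S → Σ< k (λ i → h i S)) (h k)) (cong (_+ Σ⊆ I (h k)) (Σ⊆-Σ<-comm I k h))

-- The ratio 1/32 gives series at most 1/31, below δ = 1/16. What matters later is ½ + 2δ = 5/8: it
-- is less than 3/4, which excludes empty fragments, and at most 1, which bounds the cost by ½.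
ε δ : ℚ
ε = ½ ^ℚ 5
δ = ½ ^ℚ 4

-- The induction carries the remainder `δ * ε ^ℚ k`; its step is the numerical inequality ε + δε ≤
-- δ.
geometric : ∀ k → Σ< k (λ i → ε ^ℚ ℕ.suc i) ≤ δ
geometric k = ℚ.≤-trans (x≤x+y (*-nonNeg 0≤δ (^ℚ-nonNeg k 0≤ε))) (bound k)
  where
  0≤ε : 0ℚ ≤ ε
  0≤ε = from-yes (0ℚ ℚ.≤? ε)
  0≤δ : 0ℚ ≤ δ
  0≤δ = from-yes (0ℚ ℚ.≤? δ)
  open ℚ.≤-Reasoning
  open +-*-Solver
  bound : ∀ k → Σ< k (λ i → ε ^ℚ ℕ.suc i) + δ * ε ^ℚ k ≤ δ
  bound ℕ.zero    = ℚ.≤-reflexive (trans (ℚ.+-identityˡ _) (ℚ.*-identityʳ δ))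
  bound (ℕ.suc k) = begin
    (s + ε * e) + δ * (ε * e)
      ≡⟨ solve 4 (λ s e ε δ → (s :+ ε :* e) :+ δ :* (ε :* e) := s :+ (ε :+ δ :* ε) :* e) refl s e ε δ ⟩
    s + (ε + δ * ε) * e
      ≤⟨ ℚ.+-monoʳ-≤ s (*-monoʳ-≤ (^ℚ-nonNeg k 0≤ε) (from-yes ((ε + δ * ε) ℚ.≤? δ))) ⟩
    s + δ * e
      ≤⟨ bound k ⟩
    δ ∎
    where
    s = Σ< k (λ i → ε ^ℚ ℕ.suc i)
    e = ε ^ℚ k

-- The cover

-- In the application q = Jp and x = 1/J. Each weight p^u splits as x^u q^u: the factor q^u pays for
-- passing from `W` to `Z`, and x^u outweighs the 2^(mu) subsets of a shelter, leaving ε^u.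
module Cover (r : ℕ) .{{_ : NonZero r}} {n : ℕ} (λf : Subset n → ℚ)
  (0≤λ : ∀ S → 0ℚ ≤ λf S) (λ-rank : ∀ S → ∣ S ∣ ℕ.> r → λf S ≡ 0ℚ)
  (p q x : ℚ) (0≤q : 0ℚ ≤ q) (q≤1 : q ≤ 1ℚ) (0≤x : 0ℚ ≤ x) (xq≡p : x * q ≡ p)
  (2^4r*x≡ε : 2ℚ ^ℚ (4 ℕ.* r) * x ≡ ε)
  (λ-light : Σ⊆ ⊤ (λ S → λf S * q ^ℚ ∣ S ∣) ≤ ½)
  where

  m = 4 ℕ.* r

  instance
    m≢0 : NonZero m
    m≢0 = ℕ.m*n≢0 4 r

  Covered : Subset n → Set
  Covered I = 1ℚ ≤ Σ⊆ I λf

  open Degrees r λf 0≤λ λ-rank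
  open Fragments {F = Covered} (λ I → 1ℚ ℚ.≤? Σ⊆ I λf) (λ I → Ranking.top (ranking I))
    (λ I → Ranking.top-mono (ranking I)) (λ I → Ranking.∣top∣≤ (ranking I))
    (λ I → Ranking.top⊆ (ranking I)) m
  open Expectation (1ℚ + - q) q
    (subst (_≤ 1ℚ + - q) (ℚ.+-inverseʳ q) (ℚ.+-monoˡ-≤ (- q) q≤1)) 0≤q
    (trans (ℚ.+-assoc 1ℚ (- q) q) (cong (1ℚ +_) (ℚ.+-inverseˡ q)))

  -- The empty set, of weight 1, is kept out of the cost; `minimal-nonempty` shows that for the
  -- selected `W` the cover does not miss it.
  Chosen? : ∀ W U → Dec (1 ℕ.≤ ∣ U ∣ × Minimal W U)
  Chosen? W U = (1 ℕ.≤? ∣ U ∣) ×-dec Minimal? W U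

  cost : Subset n → ℚ
  cost W = Σ⊆ (∁ W) (λ U → when (Chosen? W U) (p ^ℚ ∣ U ∣))

  0≤p^ : ∀ k → 0ℚ ≤ p ^ℚ k
  0≤p^ k = ^ℚ-nonNeg k (subst (0ℚ ≤_) xq≡p (*-nonNeg 0≤x 0≤q))

  0≤cost : ∀ W → 0ℚ ≤ cost W
  0≤cost W = Σ⊆-nonNeg (∁ W) (λ U → when-nonNeg (Chosen? W U) (0≤p^ ∣ U ∣))

  -- The index `k` stands for size k + 1, as the empty set is excluded. The size condition itself is
  -- relaxed, so that all subsets of the shelter are counted.
  sheltered : Subset n → ℕ → Subset n → ℚ
  sheltered Z k U = when (U ⊆? shelter Z (ℕ.suc k)) (x ^ℚ ℕ.suc k)

  0≤sheltered : ∀ Z k U → 0ℚ ≤ sheltered Z k U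
  0≤sheltered Z k U = when-nonNeg (U ⊆? shelter Z (ℕ.suc k)) (^ℚ-nonNeg (ℕ.suc k) 0≤x)

  chosen≤sheltered : ∀ Z U → U ⊆ Z →
    when (Chosen? (Z ─ U) U) (x ^ℚ ∣ U ∣) ≤ Σ< n (λ k → sheltered Z k U)
  chosen≤sheltered Z U U⊆Z = ℚ.≤-trans
    (when-mono (Chosen? (Z ─ U) U) ((1 ℕ.≤? ∣ U ∣) ×-dec (U ⊆? shelter Z ∣ U ∣))
      (λ (1≤∣U∣ , min) → 1≤∣U∣ , minimal⊆shelter U⊆Z min) (^ℚ-nonNeg ∣ U ∣ 0≤x))
    (term ∣ U ∣ (∣p∣≤n U))
    where
    term : ∀ u → u ℕ.≤ n → when ((1 ℕ.≤? u) ×-dec (U ⊆? shelter Z u)) (x ^ℚ u) ≤ Σ< n (λ k → sheltered Z k U)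
    term ℕ.zero    _   = Σ<-nonNeg n (λ k → 0≤sheltered Z k U)
    term (ℕ.suc k) k<n = ℚ.≤-trans
      (when-mono ((1 ℕ.≤? ℕ.suc k) ×-dec (U ⊆? shelter Z (ℕ.suc k))) (U ⊆? shelter Z (ℕ.suc k))
        proj₂ (^ℚ-nonNeg (ℕ.suc k) 0≤x))
      (Σ<-term k<n (λ k → 0≤sheltered Z k U))

  2^mu*x^u≡ε^u : ∀ u → 2ℚ ^ℚ (m ℕ.* u) * x ^ℚ u ≡ ε ^ℚ u
  2^mu*x^u≡ε^u u = begin
    2ℚ ^ℚ (m ℕ.* u) * x ^ℚ u   ≡⟨ cong (λ k → 2ℚ ^ℚ k * x ^ℚ u) (ℕ.*-comm m u) ⟩
    2ℚ ^ℚ (u ℕ.* m) * x ^ℚ u   ≡⟨ cong (_* x ^ℚ u) (^ℚ-* 2ℚ u m) ⟩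
    (2ℚ ^ℚ m) ^ℚ u * x ^ℚ u    ≡⟨ sym (^ℚ-*-distribʳ (2ℚ ^ℚ m) x u) ⟩
    (2ℚ ^ℚ m * x) ^ℚ u         ≡⟨ cong (_^ℚ u) 2^4r*x≡ε ⟩
    ε ^ℚ u                     ∎
    where open ≡-Reasoning

  Σ-sheltered≤ : ∀ Z k → Σ⊆ Z (sheltered Z k) ≤ ε ^ℚ ℕ.suc k
  Σ-sheltered≤ Z k = begin
    Σ⊆ Z (sheltered Z k)                            ≤⟨ Σ⊆-when-≤ Z A (λ _ → 0≤x^) ⟩
    Σ⊆ A (λ _ → x ^ℚ ℕ.suc k)                       ≡⟨ Σ⊆-const A (x ^ℚ ℕ.suc k) ⟩
    2ℚ ^ℚ ∣ A ∣ * x ^ℚ ℕ.suc k                      ≤⟨ *-monoʳ-≤ 0≤x^ (^ℚ-mono 1≤2 (∣shelter∣≤ Z (ℕ.suc k))) ⟩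
    2ℚ ^ℚ (m ℕ.* ℕ.suc k) * x ^ℚ ℕ.suc k            ≡⟨ 2^mu*x^u≡ε^u (ℕ.suc k) ⟩
    ε ^ℚ ℕ.suc k                                    ∎
    where
    open ℚ.≤-Reasoning
    A = shelter Z (ℕ.suc k)
    0≤x^ = ^ℚ-nonNeg (ℕ.suc k) 0≤x

  -- After the exchange of `W` for `Z` the bound holds for every `Z` separately, by summing the
  -- shelters over all sizes.
  𝔼-cost≤ : 𝔼 cost ≤ δ
  𝔼-cost≤ = begin
    𝔼 cost
      ≤⟨ 𝔼-mono (λ W → Σ⊆-mono (∁ W) (λ U _ → ℚ.≤-reflexive (factor W U))) ⟩
    𝔼 (λ W → Σ⊆ (∁ W) (λ U → g W U * q ^ℚ ∣ U ∣))
      ≤⟨ 𝔼-disjoint-union g (λ W U → when-nonNeg (Chosen? W U) (^ℚ-nonNeg ∣ U ∣ 0≤x)) ⟩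
    𝔼 (λ Z → Σ⊆ Z (λ U → g (Z ─ U) U))
      ≤⟨ 𝔼-mono per-Z ⟩
    𝔼 {n} (λ _ → δ)
      ≡⟨ 𝔼-const n δ ⟩
    δ ∎
    where
    open ℚ.≤-Reasoning
    g : Subset n → Subset n → ℚ
    g W U = when (Chosen? W U) (x ^ℚ ∣ U ∣)
    factor : ∀ W U → when (Chosen? W U) (p ^ℚ ∣ U ∣) ≡ g W U * q ^ℚ ∣ U ∣
    factor W U = trans
      (cong (when (Chosen? W U)) (trans (cong (_^ℚ ∣ U ∣) (sym xq≡p)) (^ℚ-*-distribʳ x q ∣ U ∣)))
      (when-* (Chosen? W U) (x ^ℚ ∣ U ∣) (q ^ℚ ∣ U ∣))
    per-Z : ∀ Z → Σ⊆ Z (λ U → g (Z ─ U) U) ≤ δ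
    per-Z Z = begin
      Σ⊆ Z (λ U → g (Z ─ U) U)                    ≤⟨ Σ⊆-mono Z (chosen≤sheltered Z) ⟩
      Σ⊆ Z (λ U → Σ< n (λ k → sheltered Z k U))   ≡⟨ Σ⊆-Σ<-comm Z n (sheltered Z) ⟩
      Σ< n (λ k → Σ⊆ Z (sheltered Z k))           ≤⟨ Σ<-mono n (Σ-sheltered≤ Z) ⟩
      Σ< n (λ k → ε ^ℚ ℕ.suc k)                   ≤⟨ geometric n ⟩
      δ                                           ∎

  -- One `W` has to be light and cheap simultaneously, so a single combination is averaged. With the
  -- factor 2, a value of at most 5/8 gives weight below 3/4 and cost below ½.
  potential : Subset n → ℚ
  potential W = Σ⊆ W λf + 2ℚ * cost W

  𝔼-potential≤ : 𝔼 potential ≤ ½ + 2ℚ * δ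
  𝔼-potential≤ = begin
    𝔼 potential
      ≡⟨ 𝔼-+ (λ W → Σ⊆ W λf) (λ W → 2ℚ * cost W) ⟩
    𝔼 (λ W → Σ⊆ W λf) + 𝔼 (λ W → 2ℚ * cost W)
      ≡⟨ cong₂ _+_ (𝔼-Σ⊆ λf) (𝔼-*ˡ 2ℚ cost) ⟩
    Σ⊆ ⊤ (λ S → λf S * q ^ℚ ∣ S ∣) + 2ℚ * 𝔼 cost
      ≤⟨ ℚ.+-mono-≤ λ-light (*-monoˡ-≤ 0≤2 𝔼-cost≤) ⟩
    ½ + 2ℚ * δ ∎
    where
    open ℚ.≤-Reasoning
    0≤2 : 0ℚ ≤ 2ℚ
    0≤2 = from-yes (0ℚ ℚ.≤? 2ℚ)

  -- An empty fragment means that some covered `I` is near `W` itself with u = 0. Then `W` has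
  -- weight at least 3/4, contradicting 5/8.
  minimal-nonempty : ∀ {W U} → Σ⊆ W λf ≤ ½ + 2ℚ * δ → Minimal W U → 1 ℕ.≤ ∣ U ∣
  minimal-nonempty {W} {U} light ((_ , reach) , _) = ℕ.n≢0⇒n>0 λ ∣U∣≡0 →
    let I , 1≤L , near = Reach-mono (union⊆W ∣U∣≡0) (subst (Reach (W ∪ U)) ∣U∣≡0 reach)
    in from-no (fromℕ 3 ℚ.≤? fromℕ 4 * (½ + 2ℚ * δ)) (ℚ.≤-trans
         (weight-of-near-superset {I} {W} 1≤L (λ {j} j≤n → ℕ.≤-trans
           (near (ℕ.s≤s (ℕ.≤-trans j≤n (ℕ.m≤n*m n m)))) (ℕ.m∸n≤m j (m ℕ.* 0))))
         (*-monoˡ-≤ (fromℕ-nonNeg 4) light))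
    where
    union⊆W : ∣ U ∣ ≡ 0 → W ∪ U ⊆ W
    union⊆W ∣U∣≡0 x∈ with x∈p∪q⁻ W U x∈
    ... | inj₁ x∈W = x∈W
    ... | inj₂ x∈U = contradiction x∈U (∣p∣≡0⇒x∉p ∣U∣≡0)

  cover : Small p Covered
  cover with 𝔼-attained potential
  ... | W , W-light = G , covers , weight
    where
    open ℚ.≤-Reasoning
    total≤ : potential W ≤ ½ + 2ℚ * δ
    total≤ = ℚ.≤-trans W-light 𝔼-potential≤
    0≤2cost : 0ℚ ≤ 2ℚ * cost W
    0≤2cost = *-nonNeg (from-yes (0ℚ ℚ.≤? 2ℚ)) (0≤cost W)
    cost≤½ : cost W ≤ ½
    cost≤½ = ℚ.*-cancelˡ-≤-pos 2ℚ (begin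
      2ℚ * cost W     ≤⟨ y≤x+y (Σ⊆-nonNeg W 0≤λ) ⟩
      potential W     ≤⟨ total≤ ⟩
      ½ + 2ℚ * δ      ≤⟨ from-yes ((½ + 2ℚ * δ) ℚ.≤? (2ℚ * ½)) ⟩
      2ℚ * ½          ∎)
    G : List (Subset n)
    G = filter (Chosen? W) (subsetsOf (∁ W))
    covers : CoveredBy Covered G
    covers I 1≤L =
      let U , U⊆I , min = minimal-exists W 1≤L
      in U , ∈-filter⁺ (Chosen? W) (∈-subsetsOf (proj₁ (proj₁ min)))
               (minimal-nonempty (ℚ.≤-trans (x≤x+y 0≤2cost) total≤) min , min) , U⊆I
    weight : sumℚ (map (λ S → p ^ℚ ∣ S ∣) G) ≤ ½
    weight = begin
      sumℚ (map (λ S → p ^ℚ ∣ S ∣) G)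
        ≡⟨ sum-filter (Chosen? W) (λ S → p ^ℚ ∣ S ∣) (subsetsOf (∁ W)) ⟩
      sumℚ (map (λ S → when (Chosen? W S) (p ^ℚ ∣ S ∣)) (subsetsOf (∁ W)))
        ≡⟨ sum-subsetsOf (∁ W) _ ⟩
      cost W
        ≤⟨ cost≤½ ⟩
      ½ ∎

-- Choice of the constant and conclusion

theorem1p2 : (r : ℕ) → .{{_ : NonZero r}} →
    ∃[ J ] (0ℚ < J × (∀ (n : ℕ) (F : Family n) (p : ℚ) → Increasing F → 0ℚ < p →
    WeaklySmall (J * p) r F → Small p F))
theorem1p2 r = J , 0<J , main
  where
  open +-*-Solver
  m = 4 ℕ.* r
  J x : ℚ
  -- The factor 2^m absorbs the subsets of shelters, and 2^5 = 1/ε makes the series small; `x` is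
  -- the inverse of `J`.
  J = 2ℚ ^ℚ m * 2ℚ ^ℚ 5
  x = ½ ^ℚ m * ε
  1≤J : 1ℚ ≤ J
  1≤J = subst (1ℚ ≤_) (^ℚ-+ 2ℚ m 5) (1≤^ℚ (m ℕ.+ 5) 1≤2)
  0<J : 0ℚ < J
  0<J = ℚ.<-≤-trans (ℚ.positive⁻¹ 1ℚ) 1≤J
  2^m*½^m≡1 : 2ℚ ^ℚ m * ½ ^ℚ m ≡ 1ℚ
  2^m*½^m≡1 = trans (sym (^ℚ-*-distribʳ 2ℚ ½ m)) (1^ℚ m)
  2^m*x≡ε : 2ℚ ^ℚ m * x ≡ ε
  2^m*x≡ε = trans (sym (ℚ.*-assoc (2ℚ ^ℚ m) (½ ^ℚ m) ε)) (trans (cong (_* ε) 2^m*½^m≡1) (ℚ.*-identityˡ ε))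
  x*[J*p]≡p : ∀ p → x * (J * p) ≡ p
  x*[J*p]≡p p = begin
    x * (J * p)
      ≡⟨ solve 4 (λ x a b p → x :* ((a :* b) :* p) := (a :* x) :* (b :* p)) refl x (2ℚ ^ℚ m) (2ℚ ^ℚ 5) p ⟩
    (2ℚ ^ℚ m * x) * (2ℚ ^ℚ 5 * p)
      ≡⟨ cong (_* (2ℚ ^ℚ 5 * p)) 2^m*x≡ε ⟩
    ε * (2ℚ ^ℚ 5 * p)
      ≡⟨ sym (ℚ.*-assoc ε (2ℚ ^ℚ 5) p) ⟩
    -- The closed product of `ε` and 2^5 evaluates to 1.
    1ℚ * p
      ≡⟨ ℚ.*-identityˡ p ⟩
    p ∎
    where open ≡-Reasoning
  main : ∀ n (F : Family n) p → Increasing F → 0ℚ < p → WeaklySmall (J * p) r F → Small p F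
  main n F p _ 0<p (λf , 0≤λ , λ-rank , covers , light) = split (ℚ.≤-total 1ℚ q)
    where
    q = J * p
    light′ : Σ⊆ ⊤ (λ S → λf S * q ^ℚ ∣ S ∣) ≤ ½
    light′ = subst (_≤ ½) (sumSubsets≡Σ⊆ n _) light
    covers′ : ∀ I → F I → 1ℚ ≤ Σ⊆ I λf
    covers′ I FI = ℚ.≤-trans (covers I FI) (sumSubsetsOf≤Σ⊆ I 0≤λ)
    split : 1ℚ ≤ q ⊎ q ≤ 1ℚ → Small p F
    -- No q-random set exists for q > 1. For q ≥ 1 the total weight is at most ½, so no set belongs
    -- to `F` and the empty list covers it.
    split (inj₁ 1≤q) = [] , (λ I FI → contradiction (begin
        1ℚ                               ≤⟨ covers′ I FI ⟩
        Σ⊆ I λf                          ≤⟨ Σ⊆-≤-⊤ I 0≤λ ⟩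
        Σ⊆ ⊤ λf                          ≤⟨ Σ⊆-mono ⊤ (λ S _ → subst (_≤ λf S * q ^ℚ ∣ S ∣) (ℚ.*-identityʳ (λf S))
                                              (*-monoˡ-≤ (0≤λ S) (1≤^ℚ ∣ S ∣ 1≤q))) ⟩
        Σ⊆ ⊤ (λ S → λf S * q ^ℚ ∣ S ∣)   ≤⟨ light′ ⟩
        ½                                ∎) (from-no (1ℚ ℚ.≤? ½))) , from-yes (0ℚ ℚ.≤? ½)
      where open ℚ.≤-Reasoning
    split (inj₂ q≤1) =
      let G , covered , weight = Cover.cover r λf 0≤λ λ-rank p q x 0≤q q≤1 0≤x (x*[J*p]≡p p) 2^m*x≡ε light′
      in G , (λ I FI → covered I (covers′ I FI)) , weight
      where
      0≤q : 0ℚ ≤ q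
      0≤q = *-nonNeg (ℚ.<⇒≤ 0<J) (ℚ.<⇒≤ 0<p)
      0≤x : 0ℚ ≤ x
      0≤x = *-nonNeg (^ℚ-nonNeg m (ℚ.nonNegative⁻¹ ½)) (from-yes (0ℚ ℚ.≤? ε))
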